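{- On tree metrics with $n\ge2$ servers and requests drawn i.i.d. uniformly from the server locations, algorithm FAIR-BIAS (defined below) is $4$-competitive: $\mathbb{E}[\mathrm{ALG}]\le 4\,\mathbb{E}[\mathrm{OPT}]$.
   Context: A tree metric is the shortest-path metric on the vertices of a finite tree with nonnegative edge lengths. Servers indexed by $S=[n]$ sit at vertices $s_1,\dots,s_n$ (not necessarily distinct); $d_{i,j}$ is the distance between $s_i$ and $s_j$. $n$ requests are drawn independently and uniformly from $S$ (request $j$ located at $s_j$), arriving online; each must be immediately matched to a currently free server at cost equal to their distance. $\mathrm{ALG}$ is the total cost, $\mathrm{OPT}$ the cost of an offline minimum-cost perfect matching of requests to servers. For $T\subseteq S$, $M(T)$ is the LP: minimize $\sum_{i\in T,j\in S}d_{i,j}x_{i,j}$ subject to $\sum_{j\in S}x_{i,j}=1/|T|$ for all $i\in T$, $\sum_{i\in T}x_{i,j}=1/n$ for all $j\in S$, $x\ge0$. Algorithm FAIR-BIAS: set $S_n=S$; for $k=n,\dots,1$: compute an optimal solution $x^{S_k}$ of $M(S_k)$; when request $r_k=r\in S$ arrives, choose $s\in S_k$ with probability $n\cdot x^{S_k}_{s,r}$, match $r$ to $s$, and set $S_{k-1}=S_k\setminus\{s\}$.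
   Formalization: The edge lengths of the tree (hence the distances) and the optimal LP solutions chosen by FAIR-BIAS are taken to be rational rather than real. -}

module Defs where

open import Data.Nat as ℕ using (ℕ; zero; suc)
open import Data.Fin using (Fin; zero; suc; toℕ)
open import Data.Fin.Subset using (Subset; _∈_; ∣_∣; _-_; ⊤)
open import Data.Fin.Subset.Properties using (_∈?_)
open import Data.Fin.Permutation using (Permutation′; _⟨$⟩ʳ_)
open import Data.Vec using (Vec; []; _∷_; lookup)
open import Data.Integer using (+_)
open import Data.Rational using (ℚ; 0ℚ; 1ℚ; _+_; _*_; _≤_; _/_)
open import Data.Product using (Σ; ∃; _×_; _,_)
open import Relation.Nullary using (yes; no)
open import Relation.Binary.PropositionalEquality using (_≡_)

ℕtoℚ : ℕ → ℚ
ℕtoℚ k = + k / 1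

sumFin : ∀ {n} → (Fin n → ℚ) → ℚ
sumFin {zero}  f = 0ℚ
sumFin {suc n} f = f zero + sumFin (λ i → f (suc i))

sumIn : ∀ {n} → Subset n → (Fin n → ℚ) → ℚ
sumIn T f = sumFin (λ i → indicator i)
  where
  indicator : _ → ℚ
  indicator i with i ∈? T
  ... | yes _ = f i
  ... | no  _ = 0ℚ

sumVec : ∀ {n} (k : ℕ) → (Vec (Fin n) k → ℚ) → ℚ
sumVec zero    f = f []
sumVec (suc k) f = sumFin (λ a → sumVec k (λ v → f (a ∷ v)))

-- Finite trees with nonnegative edge lengths.
-- A tree on the vertex set Fin (suc m) is given by parent pointers:
-- vertex (suc i) is joined by an edge of length (len i) to its parent
-- (par i), a vertex of strictly smaller index.  (Every finite tree
-- admits such a labelling, e.g. in BFS order from any root.)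

record Tree (m : ℕ) : Set where
  field
    par    : Fin m → Fin (suc m)
    par<   : ∀ i → toℕ (par i) ℕ.≤ toℕ i
    len    : Fin m → ℚ
    len≥0  : ∀ i → 0ℚ ≤ len i

module _ {m : ℕ} (t : Tree m) where
  open Tree t

  data Walk : Fin (suc m) → Fin (suc m) → Set where
    stop : ∀ {u} → Walk u u
    up   : ∀ i {v} → Walk (par i) v → Walk (suc i) v
    down : ∀ i {v} → Walk (suc i) v → Walk (par i) v

  walkLength : ∀ {u v} → Walk u v → ℚ
  walkLength stop       = 0ℚ
  walkLength (up i w)   = len i + walkLength w
  walkLength (down i w) = len i + walkLength w

  IsShortestPathMetric : (Fin (suc m) → Fin (suc m) → ℚ) → Set
  IsShortestPathMetric d =
    ∀ u v → (Σ (Walk u v) λ w → walkLength w ≡ d u v)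
          × (∀ (w : Walk u v) → d u v ≤ walkLength w)

module Matching {n : ℕ} (dist : Fin n → Fin n → ℚ) where

  -- feasibility of x for the LP M(T) (with i ∈ T, j ∈ S = Fin n);
  -- the constraint  Σ_j x_{i,j} = 1/|T|  is written  |T| · Σ_j x_{i,j} = 1,
  -- and  Σ_{i∈T} x_{i,j} = 1/n  as  n · Σ_{i∈T} x_{i,j} = 1.
  Feasible : Subset n → (Fin n → Fin n → ℚ) → Set
  Feasible T x =
      (∀ i → i ∈ T → ℕtoℚ ∣ T ∣ * sumFin (λ j → x i j) ≡ 1ℚ)
    × (∀ j → ℕtoℚ n * sumIn T (λ i → x i j) ≡ 1ℚ)
    × (∀ i j → i ∈ T → 0ℚ ≤ x i j)

  objective : Subset n → (Fin n → Fin n → ℚ) → ℚ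
  objective T x = sumIn T (λ i → sumFin (λ j → dist i j * x i j))

  Optimal : Subset n → (Fin n → Fin n → ℚ) → Set
  Optimal T x = Feasible T x × (∀ y → Feasible T y → objective T x ≤ objective T y)

  -- FAIR-BIAS, given a choice X T of an optimal solution of M(T) for
  -- every current set of free servers T.
  --
  -- Along a run, requests rs = (r_n, …, r_1) and chosen servers
  -- ss = (s_n, …, s_1).  pathProb gives the probability of this joint
  -- outcome: each request has probability 1/n, and given current free set
  -- S_k and request r, server s is chosen w.p. n·x^{S_k}_{s,r} if s ∈ S_k
  -- (and 0 otherwise); then S_{k-1} = S_k ∖ {s}.

  module FairBias (X : Subset n → Fin n → Fin n → ℚ) .{{_ : ℕ.NonZero n}} where

    pathProb : ∀ {k} → Subset n → Vec (Fin n) k → Vec (Fin n) k → ℚ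
    pathProb T []       []       = 1ℚ
    pathProb T (r ∷ rs) (s ∷ ss) = (+ 1 / n) * (choose * pathProb (T - s) rs ss)
      where
      choose : ℚ
      choose with s ∈? T
      ... | yes _ = ℕtoℚ n * X T s r
      ... | no  _ = 0ℚ

    pathCost : ∀ {k} → Vec (Fin n) k → Vec (Fin n) k → ℚ
    pathCost []       []       = 0ℚ
    pathCost (r ∷ rs) (s ∷ ss) = dist s r + pathCost rs ss

    expectedALG : ℚ
    expectedALG = sumVec n (λ rs → sumVec n (λ ss → pathProb ⊤ rs ss * pathCost rs ss))

  matchingCost : Vec (Fin n) n → Permutation′ n → ℚ
  matchingCost rs π = sumFin (λ j → dist (lookup rs j) (π ⟨$⟩ʳ j))

  IsOPT : Vec (Fin n) n → ℚ → Set
  IsOPT rs c = (∃ λ π → matchingCost rs π ≡ c) × (∀ π → c ≤ matchingCost rs π)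

  expectedOPT : .{{_ : ℕ.NonZero n}} → (Vec (Fin n) n → ℚ) → ℚ
  expectedOPT opt = sumVec n (λ rs → prodProb n * opt rs)
    where
    prodProb : ℕ → ℚ
    prodProb zero    = 1ℚ
    prodProb (suc k) = (+ 1 / n) * prodProb k

{-# OPTIONS --safe #-}

-- For an edge e let χ e v indicate that v lies below e, let p be the fraction of servers below e and
-- v = p (1 - p).
-- Shipping the surplus of each subtree through the edge above it shows that the optimum of M(T) is at
-- most Σ len e · ∣ hits / ∣T∣ - p ∣, where hits is the number of members of T below e; conversely every
-- matching pays at least len e for each unit of imbalance Y of the requests below e.  The server chosen
-- at each step is uniform on the free ones, so the free set is a uniformly random subset, and it remains
-- to prove Σ_k E ∣ hits_k / k - p ∣ ≤ 4 E ∣Y∣ for each edge, Y being a centred binomial(n, p).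
-- With S = n v = E Y², the bound E (hits_k / k - p)² ≤ v / k and AM-GM give at most S / s + s on the left
-- for every s > 0, and E Y⁴ ≤ 4 S² gives S ≤ 4 (E ∣Y∣)²; take s = 2 E ∣Y∣.
module Submission where

open import Defs
open import Data.Nat as ℕ using (ℕ; zero; suc; z≤n; s≤s)
import Data.Nat.Properties as ℕ
open import Data.Integer as ℤ using () renaming (+_ to pos)
import Data.Integer.Properties as ℤ
open import Data.Fin using (Fin; zero; suc; toℕ; fromℕ<)
open import Data.Fin.Permutation using (Permutation′; _⟨$⟩ʳ_)
open import Data.Fin.Properties using (_≟_; toℕ-fromℕ<; toℕ-injective; toℕ<n)
open import Data.Fin.Subset using (Subset; Nonempty; inside; outside; _∈_; _∉_; ∣_∣; ⊤) renaming (_-_ to _∖_)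
open import Data.Fin.Subset.Properties using (_∈?_; p─⊥≡p; ∣⊤∣≡n)
open import Data.Vec using (Vec; []; _∷_; lookup; here; there)
open import Data.Rational using (ℚ; 0ℚ; 1ℚ; ½; toℚᵘ; _+_; _*_; _-_; -_; _≤_; _<_; _/_; 1/_; nonNegative; positive; >-nonZero)
  renaming (∣_∣ to abs)
open import Data.Rational.Properties hiding (_≟_)
import Data.Rational.Properties as ℚ
import Data.Rational.Unnormalised as ℚᵘ
import Data.Rational.Unnormalised.Properties as ℚᵘ
open import Algebra.Properties.CommutativeMonoid.Sum +-0-commutativeMonoid using (sum; sum-permute)
open import Tactic.RingSolver using (solve-∀)
open import Tactic.RingSolver.Core.AlmostCommutativeRing using (AlmostCommutativeRing; fromCommutativeRing)
open import Data.Product using (Σ; _×_; _,_; proj₁; proj₂)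
open import Data.Sum using (_⊎_; inj₁; inj₂)
open import Function using (_∘_)
open import Relation.Nullary using (yes; no; contradiction)
open import Relation.Nullary.Decidable using (dec⇒maybe)
open import Relation.Binary.Definitions using (tri<; tri≈; tri>)
open import Relation.Binary.PropositionalEquality
  using (_≡_; _≢_; refl; sym; trans; cong; cong₂; subst; module ≡-Reasoning)

-- The constant 4 is 2 · 2: `S / s + s` has minimum 2√S, and √S ≤ 2 E ∣Y∣. These roots need not
-- exist in ℚ, and this shapes the proof: where a square root would appear, AM-GM is used with a
-- pair of reciprocal weights, and the weights at size k must imitate √k while their sums stay in
-- closed form. This is the origin of `β`. Uniformity of the chosen server comes from the row
-- constraints alone: averaging n · x over a uniform request leaves a row sum, 1 / ∣T∣, whichever
-- optimum is taken. No law of the free set is ever written down; the cost is bounded by induction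
-- on the number of free servers, against a potential per edge that depends only on that number and
-- on the fraction of hits. For a binomial with small mean, E Y⁴ ≤ 4 S² is false. It holds here
-- because n p is an integer: an edge with servers on both sides has at least one on each, which
-- keeps v at or above (n - 1) / n².

ℚ-ring : AlmostCommutativeRing _ _
ℚ-ring = fromCommutativeRing +-*-commutativeRing (λ x → dec⇒maybe (0ℚ ℚ.≟ x))

-- Order, absolute values and casts in ℚ

p≤q⇒0≤q-p : ∀ {p q} → p ≤ q → 0ℚ ≤ q - p
p≤q⇒0≤q-p {p} {q} h = subst (_≤ q - p) (+-inverseʳ p) (+-monoˡ-≤ (- p) h)

-- The format of most polynomial inequalities below: the slack `r` is displayed as a visibly
-- nonnegative expression, and the ring solver checks the identity.
≤-by-gap : ∀ {p q} r → 0ℚ ≤ r → q ≡ p + r → p ≤ q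
≤-by-gap {p} r 0≤r refl = subst (_≤ p + r) (+-identityʳ p) (+-monoʳ-≤ p 0≤r)

+-nonneg : ∀ {p q} → 0ℚ ≤ p → 0ℚ ≤ q → 0ℚ ≤ p + q
+-nonneg = +-mono-≤

*-nonneg : ∀ {p q} → 0ℚ ≤ p → 0ℚ ≤ q → 0ℚ ≤ p * q
*-nonneg {p} {q} 0≤p 0≤q =
  subst (_≤ p * q) (*-zeroʳ p) (*-monoˡ-≤-nonNeg p {{nonNegative 0≤p}} 0≤q)

*-pos : ∀ {p q} → 0ℚ < p → 0ℚ < q → 0ℚ < p * q
*-pos {p} {q} 0<p 0<q = positive⁻¹ (p * q) {{pos*pos⇒pos p {{positive 0<p}} q {{positive 0<q}}}}

*-mono-nonneg : ∀ {r p q} → 0ℚ ≤ r → p ≤ q → r * p ≤ r * q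
*-mono-nonneg {r} 0≤r = *-monoˡ-≤-nonNeg r {{nonNegative 0≤r}}

*-cancel-pos : ∀ {r p q} → 0ℚ < r → r * p ≤ r * q → p ≤ q
*-cancel-pos {r} 0<r = *-cancelˡ-≤-pos r {{positive 0<r}}

square-nonneg : ∀ p → 0ℚ ≤ p * p
square-nonneg p with ≤-total 0ℚ p
... | inj₁ 0≤p = *-nonneg 0≤p 0≤p
... | inj₂ p≤0 = subst (0ℚ ≤_) (lem p) (*-nonneg (neg-antimono-≤ p≤0) (neg-antimono-≤ p≤0))
  where
  lem : ∀ p → (- p) * (- p) ≡ p * p
  lem = solve-∀ ℚ-ring

abs-square : ∀ p → abs p * abs p ≡ p * p
abs-square p with ∣p∣≡p∨∣p∣≡-p p
... | inj₁ eq rewrite eq = refl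
... | inj₂ eq rewrite eq = lem p
  where
  lem : ∀ p → (- p) * (- p) ≡ p * p
  lem = solve-∀ ℚ-ring

p≤∣p∣ : ∀ p → p ≤ abs p
p≤∣p∣ p with ≤-total 0ℚ p
... | inj₁ 0≤p = ≤-reflexive (sym (0≤p⇒∣p∣≡p 0≤p))
... | inj₂ p≤0 = ≤-trans p≤0 (0≤∣p∣ p)

ℕtoℚ-suc : ∀ k → ℕtoℚ (suc k) ≡ 1ℚ + ℕtoℚ k
ℕtoℚ-suc k = toℚᵘ-injective (begin
  toℚᵘ (pos (suc k) / 1)                     ≈⟨ toℚᵘ-fromℚᵘ (ℚᵘ.mkℚᵘ (pos (suc k)) 0) ⟩
  ℚᵘ.mkℚᵘ (pos (suc k)) 0                                  ≈⟨ ℚᵘ.*≡* (cong (ℤ._* pos 1) (cong ℤ.suc (sym (ℤ.*-identityʳ (pos k))))) ⟩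
  ℚᵘ.1ℚᵘ ℚᵘ.+ ℚᵘ.mkℚᵘ (pos k) 0                          ≈⟨ ℚᵘ.+-congʳ ℚᵘ.1ℚᵘ (toℚᵘ-fromℚᵘ (ℚᵘ.mkℚᵘ (pos k) 0)) ⟨
  toℚᵘ 1ℚ ℚᵘ.+ toℚᵘ (pos k / 1) ≈⟨ toℚᵘ-homo-+ 1ℚ (pos k / 1) ⟨
  toℚᵘ (1ℚ + (pos k / 1)) ∎)
  where open ℚᵘ.≃-Reasoning

n*[1/n]≡1 : ∀ n .{{_ : ℕ.NonZero n}} → ℕtoℚ n * (pos 1 / n) ≡ 1ℚ
n*[1/n]≡1 (suc n) = toℚᵘ-injective (begin
  toℚᵘ (ℕtoℚ (suc n) * (pos 1 / suc n)) ≈⟨ toℚᵘ-homo-* (ℕtoℚ (suc n)) (pos 1 / suc n) ⟩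
  toℚᵘ (ℕtoℚ (suc n)) ℚᵘ.* toℚᵘ (pos 1 / suc n)
    ≈⟨ ℚᵘ.*-cong (toℚᵘ-fromℚᵘ (ℚᵘ.mkℚᵘ (pos (suc n)) 0)) (toℚᵘ-fromℚᵘ (ℚᵘ.mkℚᵘ (pos 1) n)) ⟩
  ℚᵘ.mkℚᵘ (pos (suc n)) 0 ℚᵘ.* ℚᵘ.mkℚᵘ (pos 1) n ≈⟨ ℚᵘ.*≡* (trans (ℤ.*-identityʳ (pos (suc n) ℤ.* pos 1)) (trans (ℤ.*-identityʳ (pos (suc n))) (sym (trans (ℤ.*-identityˡ (pos 1 ℤ.* pos (suc n))) (ℤ.*-identityˡ (pos (suc n))))))) ⟩
  ℚᵘ.1ℚᵘ ∎)
  where open ℚᵘ.≃-Reasoning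

0≤ℕtoℚ : ∀ k → 0ℚ ≤ ℕtoℚ k
0≤ℕtoℚ zero = ≤-refl
0≤ℕtoℚ (suc k) = subst (0ℚ ≤_) (sym (ℕtoℚ-suc k)) (+-nonneg (nonNegative⁻¹ 1ℚ) (0≤ℕtoℚ k))

0<ℕtoℚ : ∀ k → 0ℚ < ℕtoℚ (suc k)
0<ℕtoℚ k = subst (0ℚ <_) (sym (ℕtoℚ-suc k)) (+-mono-<-≤ (positive⁻¹ 1ℚ) (0≤ℕtoℚ k))

0≤1/n : ∀ n .{{_ : ℕ.NonZero n}} → 0ℚ ≤ pos 1 / n
0≤1/n (suc n) = *-cancel-pos (0<ℕtoℚ n) (begin
  ℕtoℚ (suc n) * 0ℚ             ≡⟨ *-zeroʳ (ℕtoℚ (suc n)) ⟩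
  0ℚ                            ≤⟨ nonNegative⁻¹ 1ℚ ⟩
  1ℚ                            ≡⟨ n*[1/n]≡1 (suc n) ⟨
  ℕtoℚ (suc n) * (pos 1 / suc n)  ∎)
  where open ≤-Reasoning

-- Positive linear functionals

record IsSum {A : Set} (S : (A → ℚ) → ℚ) : Set where
  field
    S-cong : ∀ {f g} → (∀ x → f x ≡ g x) → S f ≡ S g
    S-+    : ∀ f g → S (λ x → f x + g x) ≡ S f + S g
    S-*    : ∀ c f → S (λ x → c * f x) ≡ c * S f
    S-mono : ∀ {f g} → (∀ x → f x ≤ g x) → S f ≤ S g

  S-0 : S (λ _ → 0ℚ) ≡ 0ℚ
  S-0 = trans (S-* 0ℚ (λ _ → 0ℚ)) (*-zeroˡ (S (λ _ → 0ℚ)))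

  S-nonneg : ∀ {f} → (∀ x → 0ℚ ≤ f x) → 0ℚ ≤ S f
  S-nonneg {f} h = subst (_≤ S f) S-0 (S-mono h)

  S-*ʳ : ∀ f c → S (λ x → f x * c) ≡ S f * c
  S-*ʳ f c = trans (S-cong (λ x → *-comm (f x) c)) (trans (S-* c f) (*-comm c (S f)))

  S-neg : ∀ f → S (λ x → - f x) ≡ - S f
  S-neg f = trans (S-cong (λ x → lem (f x))) (trans (S-* (- 1ℚ) f) (sym (lem (S f))))
    where
    lem : ∀ p → - p ≡ (- 1ℚ) * p
    lem = solve-∀ ℚ-ring

  S-- : ∀ f g → S (λ x → f x - g x) ≡ S f - S g
  S-- f g = trans (S-+ f (λ x → - g x)) (cong (S f +_) (S-neg g))

  -- Positivity and linearity suffice: both `S f` and `- S f` are values of `S` at functions lying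
  -- pointwise below `abs (f x)`.
  abs-S : ∀ f → abs (S f) ≤ S (λ x → abs (f x))
  abs-S f with ∣p∣≡p∨∣p∣≡-p (S f)
  ... | inj₁ eq = subst (_≤ S (λ x → abs (f x))) (sym eq) (S-mono (λ x → p≤∣p∣ (f x)))
  ... | inj₂ eq = subst (_≤ S (λ x → abs (f x))) (trans (S-neg f) (sym eq))
    (S-mono (λ x → subst (- f x ≤_) (∣-p∣≡∣p∣ (f x)) (p≤∣p∣ (- f x))))

  S-comm-Fin : ∀ {n} (f : A → Fin n → ℚ) →
    S (λ x → sumFin (f x)) ≡ sumFin (λ i → S (λ x → f x i))
  S-comm-Fin {zero}  f = S-0
  S-comm-Fin {suc n} f =
    trans (S-+ (λ x → f x zero) (λ x → sumFin (λ i → f x (suc i)))) (cong (S (λ x → f x zero) +_) (S-comm-Fin (λ x i → f x (suc i))))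

sumFin-isSum : ∀ {n} → IsSum (sumFin {n})
sumFin-isSum = record { S-cong = s-cong ; S-+ = s-+ ; S-* = s-* ; S-mono = s-mono }
  where
  s-cong : ∀ {n} {f g : Fin n → ℚ} → (∀ x → f x ≡ g x) → sumFin f ≡ sumFin g
  s-cong {zero}  h = refl
  s-cong {suc n} h = cong₂ _+_ (h zero) (s-cong (h ∘ suc))
  s-+ : ∀ {n} (f g : Fin n → ℚ) → sumFin (λ x → f x + g x) ≡ sumFin f + sumFin g
  s-+ {zero}  f g = refl
  s-+ {suc n} f g = trans (cong (f zero + g zero +_) (s-+ (f ∘ suc) (g ∘ suc))) (lem (f zero) (g zero) (sumFin (f ∘ suc)) (sumFin (g ∘ suc)))
    where
    lem : ∀ a b c d → (a + b) + (c + d) ≡ (a + c) + (b + d)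
    lem = solve-∀ ℚ-ring
  s-* : ∀ {n} c (f : Fin n → ℚ) → sumFin (λ x → c * f x) ≡ c * sumFin f
  s-* {zero}  c f = sym (*-zeroʳ c)
  s-* {suc n} c f = trans (cong (c * f zero +_) (s-* c (f ∘ suc))) (sym (*-distribˡ-+ c (f zero) (sumFin (f ∘ suc))))
  s-mono : ∀ {n} {f g : Fin n → ℚ} → (∀ x → f x ≤ g x) → sumFin f ≤ sumFin g
  s-mono {zero}  h = ≤-refl
  s-mono {suc n} h = +-mono-≤ (h zero) (s-mono (h ∘ suc))

module ΣF {n : ℕ} = IsSum (sumFin-isSum {n})

sumVec-comm : ∀ {A : Set} {S : (A → ℚ) → ℚ} → IsSum S → ∀ {n} k (f : A → Vec (Fin n) k → ℚ) →
  S (λ x → sumVec k (f x)) ≡ sumVec k (λ v → S (λ x → f x v))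
sumVec-comm S-isSum zero    f = refl
sumVec-comm S-isSum (suc k) f =
  trans (IsSum.S-comm-Fin S-isSum (λ x a → sumVec k (λ v → f x (a ∷ v))))
        (ΣF.S-cong (λ a → sumVec-comm S-isSum k (λ x v → f x (a ∷ v))))

sumVec-isSum : ∀ {n} k → IsSum (sumVec {n} k)
sumVec-isSum zero = record
  { S-cong = λ h → h [] ; S-+ = λ _ _ → refl ; S-* = λ _ _ → refl ; S-mono = λ h → h [] }
sumVec-isSum (suc k) = record
  { S-cong = λ h → ΣF.S-cong (λ a → V.S-cong (λ v → h (a ∷ v)))
  ; S-+    = λ f g → trans (ΣF.S-cong (λ a → V.S-+ (λ v → f (a ∷ v)) (λ v → g (a ∷ v)))) (ΣF.S-+ (λ a → sumVec k (λ v → f (a ∷ v))) (λ a → sumVec k (λ v → g (a ∷ v))))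
  ; S-*    = λ c f → trans (ΣF.S-cong (λ a → V.S-* c (λ v → f (a ∷ v)))) (ΣF.S-* c (λ a → sumVec k (λ v → f (a ∷ v))))
  ; S-mono = λ h → ΣF.S-mono (λ a → V.S-mono (λ v → h (a ∷ v))) }
  where module V = IsSum (sumVec-isSum k)

module ΣV {n : ℕ} (k : ℕ) = IsSum (sumVec-isSum {n} k)

sumFin-const : ∀ n c → sumFin {n} (λ _ → c) ≡ ℕtoℚ n * c
sumFin-const zero    c = sym (*-zeroˡ c)
sumFin-const (suc n) c = begin
  c + sumFin {n} (λ _ → c)  ≡⟨ cong (c +_) (sumFin-const n c) ⟩
  c + ℕtoℚ n * c            ≡⟨ lem c (ℕtoℚ n) ⟩
  (1ℚ + ℕtoℚ n) * c         ≡⟨ cong (_* c) (ℕtoℚ-suc n) ⟨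
  ℕtoℚ (suc n) * c          ∎
  where
  open ≡-Reasoning
  lem : ∀ c x → c + x * c ≡ (1ℚ + x) * c
  lem = solve-∀ ℚ-ring

sumFin-permute : ∀ {n} (f : Fin n → ℚ) (π : Permutation′ n) → sumFin (λ j → f (π ⟨$⟩ʳ j)) ≡ sumFin f
sumFin-permute f π = trans (sumFin≡sum (λ j → f (π ⟨$⟩ʳ j))) (trans (sym (sum-permute f π)) (sym (sumFin≡sum f)))
  where
  sumFin≡sum : ∀ {n} (f : Fin n → ℚ) → sumFin f ≡ sum f
  sumFin≡sum {zero}  f = refl
  sumFin≡sum {suc n} f = cong (f zero +_) (sumFin≡sum (f ∘ suc))

-- The run of FAIR-BIAS

-- Recursion on the vector, rather than a call to `_∈?_`, lets sums over `T` unfold one entry at a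
-- time, as `sum-𝟙` and `sum-𝟙-∖` require.
𝟙 : ∀ {n} → Subset n → Fin n → ℚ
𝟙 (_       ∷ T) (suc i) = 𝟙 T i
𝟙 (inside  ∷ T) zero    = 1ℚ
𝟙 (outside ∷ T) zero    = 0ℚ

𝟙-∈ : ∀ {n} {T : Subset n} {i} → i ∈ T → 𝟙 T i ≡ 1ℚ
𝟙-∈ {T = inside ∷ T} here        = refl
𝟙-∈ {T = _ ∷ T}      (there i∈T) = 𝟙-∈ i∈T

𝟙-∉ : ∀ {n} {T : Subset n} {i} → i ∉ T → 𝟙 T i ≡ 0ℚ
𝟙-∉ {T = inside ∷ T}  {zero}  i∉T = contradiction here i∉T
𝟙-∉ {T = outside ∷ T} {zero}  i∉T = refl
𝟙-∉ {T = _ ∷ T}       {suc i} i∉T = 𝟙-∉ (i∉T ∘ there)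

𝟙*-∈ : ∀ {n} {T : Subset n} {i} x → i ∈ T → 𝟙 T i * x ≡ x
𝟙*-∈ x i∈T = trans (cong (_* x) (𝟙-∈ i∈T)) (*-identityˡ x)

𝟙*-∉ : ∀ {n} {T : Subset n} {i} x → i ∉ T → 𝟙 T i * x ≡ 0ℚ
𝟙*-∉ x i∉T = trans (cong (_* x) (𝟙-∉ i∉T)) (*-zeroˡ x)

𝟙*-cong : ∀ {n} (T : Subset n) i {x y} → (i ∈ T → x ≡ y) → 𝟙 T i * x ≡ 𝟙 T i * y
𝟙*-cong T i {x} {y} h with i ∈? T
... | yes i∈T = cong (𝟙 T i *_) (h i∈T)
... | no  i∉T = trans (𝟙*-∉ x i∉T) (sym (𝟙*-∉ y i∉T))

𝟙*-mono : ∀ {n} (T : Subset n) i {x y} → (i ∈ T → x ≤ y) → 𝟙 T i * x ≤ 𝟙 T i * y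
𝟙*-mono T i {x} {y} h with i ∈? T
... | yes i∈T = subst (_≤ 𝟙 T i * y) (sym (𝟙*-∈ x i∈T)) (subst (x ≤_) (sym (𝟙*-∈ y i∈T)) (h i∈T))
... | no  i∉T = ≤-reflexive (trans (𝟙*-∉ x i∉T) (sym (𝟙*-∉ y i∉T)))

0≤𝟙 : ∀ {n} (T : Subset n) i → 0ℚ ≤ 𝟙 T i
0≤𝟙 (inside  ∷ T) zero    = nonNegative⁻¹ 1ℚ
0≤𝟙 (outside ∷ T) zero    = ≤-refl
0≤𝟙 (_       ∷ T) (suc i) = 0≤𝟙 T i

private
  -- `indicator` is local to `sumIn` and cannot be named here. Unification fills the witness with
  -- it, and `proj₁` then gives a handle on which `with` can act.
  sumIn-unfold : ∀ {n} (T : Subset n) (f : Fin n → ℚ) → Σ (Fin n → ℚ) λ g → sumIn T f ≡ sumFin g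
  sumIn-unfold T f = _ , refl

sumIn≡ : ∀ {n} (T : Subset n) (f : Fin n → ℚ) → sumIn T f ≡ sumFin (λ i → 𝟙 T i * f i)
sumIn≡ T f = ΣF.S-cong indicator≡
  where
  indicator≡ : ∀ i → proj₁ (sumIn-unfold T f) i ≡ 𝟙 T i * f i
  indicator≡ i with i ∈? T
  ... | yes i∈T = sym (𝟙*-∈ (f i) i∈T)
  ... | no  i∉T = sym (𝟙*-∉ (f i) i∉T)

sum-𝟙 : ∀ {n} (T : Subset n) → sumFin (𝟙 T) ≡ ℕtoℚ ∣ T ∣
sum-𝟙 []            = refl
sum-𝟙 (inside ∷ T)  = trans (cong (1ℚ +_) (sum-𝟙 T)) (sym (ℕtoℚ-suc ∣ T ∣))
sum-𝟙 (outside ∷ T) = trans (+-identityˡ (sumFin (𝟙 T))) (sum-𝟙 T)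

sum-𝟙-∖ : ∀ {n} {T : Subset n} {s} (f : Fin n → ℚ) → s ∈ T →
  sumFin (λ i → 𝟙 (T ∖ s) i * f i) ≡ sumFin (λ i → 𝟙 T i * f i) - f s
sum-𝟙-∖ {T = inside ∷ T} f here = begin
  -- Removing the head leaves the tail minus the empty set, which equals `T` only propositionally.
  0ℚ * f zero + sumFin (λ i → 𝟙 (T ∖ᵥ) i * f (suc i))  ≡⟨ cong (λ U → 0ℚ * f zero + sumFin (λ i → 𝟙 U i * f (suc i))) (p─⊥≡p T) ⟩
  0ℚ * f zero + sumFin (λ i → 𝟙 T i * f (suc i))        ≡⟨ lem (f zero) (sumFin (λ i → 𝟙 T i * f (suc i))) ⟩
  1ℚ * f zero + sumFin (λ i → 𝟙 T i * f (suc i)) - f zero ∎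
  where
  open ≡-Reasoning
  open import Data.Fin.Subset using (⊥; _─_)
  _∖ᵥ : ∀ {n} → Subset n → Subset n
  U ∖ᵥ = U ─ ⊥
  lem : ∀ x y → 0ℚ * x + y ≡ 1ℚ * x + y - x
  lem = solve-∀ ℚ-ring
sum-𝟙-∖ {T = inside ∷ T} {suc s} f (there s∈T) =
  trans (cong (1ℚ * f zero +_) (sum-𝟙-∖ (f ∘ suc) s∈T)) (sym (+-assoc (1ℚ * f zero) (sumFin (λ i → 𝟙 T i * f (suc i))) (- f (suc s))))
sum-𝟙-∖ {T = outside ∷ T} {suc s} f (there s∈T) =
  trans (cong (0ℚ * f zero +_) (sum-𝟙-∖ (f ∘ suc) s∈T)) (sym (+-assoc (0ℚ * f zero) (sumFin (λ i → 𝟙 T i * f (suc i))) (- f (suc s))))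

∣T∣≡1+∣T∖s∣ : ∀ {n} {T : Subset n} {s} → s ∈ T → ∣ T ∣ ≡ suc ∣ T ∖ s ∣
∣T∣≡1+∣T∖s∣ {T = inside ∷ T}  here        = cong (suc ∘ ∣_∣) (sym (p─⊥≡p T))
∣T∣≡1+∣T∖s∣ {T = inside ∷ T}  (there s∈T) = cong suc (∣T∣≡1+∣T∖s∣ s∈T)
∣T∣≡1+∣T∖s∣ {T = outside ∷ T} (there s∈T) = ∣T∣≡1+∣T∖s∣ s∈T

∣T∣≡suc⇒nonempty : ∀ {n k} (T : Subset n) → ∣ T ∣ ≡ suc k → Nonempty T
∣T∣≡suc⇒nonempty (inside ∷ T)  h = zero , here
∣T∣≡suc⇒nonempty (outside ∷ T) h with ∣T∣≡suc⇒nonempty T h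
... | i , i∈T = suc i , there i∈T

𝟙-⊤ : ∀ {n} (i : Fin n) → 𝟙 ⊤ i ≡ 1ℚ
𝟙-⊤ zero    = refl
𝟙-⊤ (suc i) = 𝟙-⊤ i

module _ {n : ℕ} .{{nz : ℕ.NonZero n}} (dist : Fin n → Fin n → ℚ) (X : Subset n → Fin n → Fin n → ℚ)
  (optimal : ∀ T → Nonempty T → Matching.Optimal dist T (X T)) where
  open Matching dist
  open FairBias X

  private
    choose≡ : ∀ {k} T r s (rs ss : Vec (Fin n) k) →
      pathProb T (r ∷ rs) (s ∷ ss) ≡ (pos 1 / n) * (𝟙 T s * (ℕtoℚ n * X T s r) * pathProb (T ∖ s) rs ss)
    choose≡ T r s rs ss with s ∈? T
    ... | yes s∈T = cong (λ c → (pos 1 / n) * (c * pathProb (T ∖ s) rs ss)) (sym (𝟙*-∈ (ℕtoℚ n * X T s r) s∈T))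
    ... | no  s∉T = cong (λ c → (pos 1 / n) * (c * pathProb (T ∖ s) rs ss)) (sym (𝟙*-∉ (ℕtoℚ n * X T s r) s∉T))

  -- The probability 1/n of the request cancels the factor n of the choice, so for `s ∈ T` the entry
  -- `X T s r` is itself the joint probability of the pair (r , s).
  pathProb-∷ : ∀ {k} T r s (rs ss : Vec (Fin n) k) →
    pathProb T (r ∷ rs) (s ∷ ss) ≡ 𝟙 T s * (X T s r * pathProb (T ∖ s) rs ss)
  pathProb-∷ T r s rs ss = begin
    pathProb T (r ∷ rs) (s ∷ ss)                        ≡⟨ choose≡ T r s rs ss ⟩
    (pos 1 / n) * (𝟙 T s * (ℕtoℚ n * X T s r) * P)      ≡⟨ lem (pos 1 / n) (𝟙 T s) (ℕtoℚ n) (X T s r) P ⟩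
    (ℕtoℚ n * (pos 1 / n)) * (𝟙 T s * (X T s r * P))    ≡⟨ cong (_* (𝟙 T s * (X T s r * P))) (n*[1/n]≡1 n) ⟩
    1ℚ * (𝟙 T s * (X T s r * P))                        ≡⟨ *-identityˡ (𝟙 T s * (X T s r * P)) ⟩
    𝟙 T s * (X T s r * P)                               ∎
    where
    open ≡-Reasoning
    P = pathProb (T ∖ s) rs ss
    lem : ∀ u i n x p → u * (i * (n * x) * p) ≡ (n * u) * (i * (x * p))
    lem = solve-∀ ℚ-ring

  -- First-step analysis: condition on the first request and server. A general `f` serves both the
  -- total probability and the expected cost.
  sum-paths-∷ : ∀ k T (f : Vec (Fin n) (suc k) → Vec (Fin n) (suc k) → ℚ) →
    sumVec (suc k) (λ rs → sumVec (suc k) (λ ss → pathProb T rs ss * f rs ss)) ≡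
    sumFin (λ r → sumFin (λ s → 𝟙 T s * (X T s r *
      sumVec k (λ rs → sumVec k (λ ss → pathProb (T ∖ s) rs ss * f (r ∷ rs) (s ∷ ss))))))
  sum-paths-∷ k T f = ΣF.S-cong (λ r → begin
    sumVec k (λ rs → sumFin (λ s → sumVec k (λ ss → pathProb T (r ∷ rs) (s ∷ ss) * f (r ∷ rs) (s ∷ ss))))
      ≡⟨ IsSum.S-comm-Fin (sumVec-isSum k) (λ rs s → sumVec k (λ ss → pathProb T (r ∷ rs) (s ∷ ss) * f (r ∷ rs) (s ∷ ss))) ⟩
    sumFin (λ s → sumVec k (λ rs → sumVec k (λ ss → pathProb T (r ∷ rs) (s ∷ ss) * f (r ∷ rs) (s ∷ ss))))
      ≡⟨ ΣF.S-cong (λ s → pull r s) ⟩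
    sumFin (λ s → 𝟙 T s * (X T s r * sumVec k (λ rs → sumVec k (λ ss → pathProb (T ∖ s) rs ss * f (r ∷ rs) (s ∷ ss))))) ∎)
    where
    open ≡-Reasoning
    lem : ∀ i x p f → i * (x * p) * f ≡ (i * x) * (p * f)
    lem = solve-∀ ℚ-ring
    pull : ∀ r s → sumVec k (λ rs → sumVec k (λ ss → pathProb T (r ∷ rs) (s ∷ ss) * f (r ∷ rs) (s ∷ ss))) ≡
      𝟙 T s * (X T s r * sumVec k (λ rs → sumVec k (λ ss → pathProb (T ∖ s) rs ss * f (r ∷ rs) (s ∷ ss))))
    pull r s = begin
      sumVec k (λ rs → sumVec k (λ ss → pathProb T (r ∷ rs) (s ∷ ss) * f (r ∷ rs) (s ∷ ss)))
        ≡⟨ ΣV.S-cong k (λ rs → trans (ΣV.S-cong k (λ ss →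
             trans (cong (_* f (r ∷ rs) (s ∷ ss)) (pathProb-∷ T r s rs ss))
                   (lem (𝟙 T s) (X T s r) (pathProb (T ∖ s) rs ss) (f (r ∷ rs) (s ∷ ss)))))
             (ΣV.S-* k (𝟙 T s * X T s r) (λ ss → pathProb (T ∖ s) rs ss * f (r ∷ rs) (s ∷ ss)))) ⟩
      sumVec k (λ rs → (𝟙 T s * X T s r) * sumVec k (λ ss → pathProb (T ∖ s) rs ss * f (r ∷ rs) (s ∷ ss)))
        ≡⟨ ΣV.S-* k (𝟙 T s * X T s r) (λ rs → sumVec k (λ ss → pathProb (T ∖ s) rs ss * f (r ∷ rs) (s ∷ ss))) ⟩
      (𝟙 T s * X T s r) * sumVec k (λ rs → sumVec k (λ ss → pathProb (T ∖ s) rs ss * f (r ∷ rs) (s ∷ ss)))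
        ≡⟨ *-assoc (𝟙 T s) (X T s r) (sumVec k (λ rs → sumVec k (λ ss → pathProb (T ∖ s) rs ss * f (r ∷ rs) (s ∷ ss)))) ⟩
      𝟙 T s * (X T s r * sumVec k (λ rs → sumVec k (λ ss → pathProb (T ∖ s) rs ss * f (r ∷ rs) (s ∷ ss)))) ∎

  ALG-from : ℕ → Subset n → ℚ
  ALG-from k T = sumVec k (λ rs → sumVec k (λ ss → pathProb T rs ss * pathCost rs ss))

  server-uniform : ∀ {k} T → ∣ T ∣ ≡ suc k → ∀ s → s ∈ T → sumFin (λ r → X T s r) ≡ pos 1 / suc k
  server-uniform {k} T ∣T∣≡ s s∈T = begin
    Y                                        ≡⟨ *-identityˡ Y ⟨
    1ℚ * Y                                   ≡⟨ cong (_* Y) (n*[1/n]≡1 (suc k)) ⟨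
    (ℕtoℚ (suc k) * (pos 1 / suc k)) * Y     ≡⟨ lem (ℕtoℚ (suc k)) (pos 1 / suc k) Y ⟩
    (pos 1 / suc k) * (ℕtoℚ (suc k) * Y)     ≡⟨ cong (λ j → (pos 1 / suc k) * (ℕtoℚ j * Y)) ∣T∣≡ ⟨
    (pos 1 / suc k) * (ℕtoℚ ∣ T ∣ * Y)       ≡⟨ cong ((pos 1 / suc k) *_) (proj₁ (proj₁ (optimal T (∣T∣≡suc⇒nonempty T ∣T∣≡))) s s∈T) ⟩
    (pos 1 / suc k) * 1ℚ                     ≡⟨ *-identityʳ (pos 1 / suc k) ⟩
    pos 1 / suc k                            ∎
    where
    open ≡-Reasoning
    Y = sumFin (λ r → X T s r)
    lem : ∀ a b y → (a * b) * y ≡ b * (a * y)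
    lem = solve-∀ ℚ-ring

  -- When the continuation depends on the server only, summing out the request turns `X T s` into
  -- its row sum: the server removed is uniform on `T`.
  sum-servers-uniform : ∀ {k} T → ∣ T ∣ ≡ suc k → (g : Fin n → ℚ) →
    sumFin (λ r → sumFin (λ s → 𝟙 T s * (X T s r * g s))) ≡ (pos 1 / suc k) * sumFin (λ s → 𝟙 T s * g s)
  sum-servers-uniform {k} T ∣T∣≡ g = begin
    sumFin (λ r → sumFin (λ s → 𝟙 T s * (X T s r * g s)))
      ≡⟨ ΣF.S-comm-Fin (λ r s → 𝟙 T s * (X T s r * g s)) ⟩
    sumFin (λ s → sumFin (λ r → 𝟙 T s * (X T s r * g s)))
      ≡⟨ ΣF.S-cong (λ s → trans (ΣF.S-* (𝟙 T s) (λ r → X T s r * g s))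
           (cong (𝟙 T s *_) (ΣF.S-*ʳ (λ r → X T s r) (g s)))) ⟩
    sumFin (λ s → 𝟙 T s * (sumFin (λ r → X T s r) * g s))
      ≡⟨ ΣF.S-cong (λ s → 𝟙*-cong T s (λ s∈T → cong (_* g s) (server-uniform T ∣T∣≡ s s∈T))) ⟩
    sumFin (λ s → 𝟙 T s * ((pos 1 / suc k) * g s))
      ≡⟨ ΣF.S-cong (λ s → lem (𝟙 T s) (pos 1 / suc k) (g s)) ⟩
    sumFin (λ s → (pos 1 / suc k) * (𝟙 T s * g s))
      ≡⟨ ΣF.S-* (pos 1 / suc k) (λ s → 𝟙 T s * g s) ⟩
    (pos 1 / suc k) * sumFin (λ s → 𝟙 T s * g s) ∎
    where
    open ≡-Reasoning
    lem : ∀ i u g → i * (u * g) ≡ u * (i * g)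
    lem = solve-∀ ℚ-ring

  -- The factor `1ℚ` is the constant cost in `sum-paths-∷`, so that the same recursion applies.
  sum-pathProb : ∀ k T → ∣ T ∣ ≡ k → sumVec k (λ rs → sumVec k (λ ss → pathProb T rs ss * 1ℚ)) ≡ 1ℚ
  sum-pathProb zero    T ∣T∣≡ = refl
  sum-pathProb (suc k) T ∣T∣≡ = begin
    sumVec (suc k) (λ rs → sumVec (suc k) (λ ss → pathProb T rs ss * 1ℚ))
      ≡⟨ sum-paths-∷ k T (λ _ _ → 1ℚ) ⟩
    sumFin (λ r → sumFin (λ s → 𝟙 T s * (X T s r * sumVec k (λ rs → sumVec k (λ ss → pathProb (T ∖ s) rs ss * 1ℚ)))))
      ≡⟨ ΣF.S-cong (λ r → ΣF.S-cong (λ s → 𝟙*-cong T s (λ s∈T → cong (X T s r *_) (sum-pathProb k (T ∖ s) (ℕ.suc-injective (trans (sym (∣T∣≡1+∣T∖s∣ s∈T)) ∣T∣≡)))))) ⟩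
    sumFin (λ r → sumFin (λ s → 𝟙 T s * (X T s r * 1ℚ)))
      ≡⟨ sum-servers-uniform T ∣T∣≡ (λ _ → 1ℚ) ⟩
    (pos 1 / suc k) * sumFin (λ s → 𝟙 T s * 1ℚ)
      ≡⟨ cong ((pos 1 / suc k) *_) (trans (ΣF.S-cong (λ s → *-identityʳ (𝟙 T s))) (sum-𝟙 T)) ⟩
    (pos 1 / suc k) * ℕtoℚ ∣ T ∣
      ≡⟨ cong (λ j → (pos 1 / suc k) * ℕtoℚ j) ∣T∣≡ ⟩
    (pos 1 / suc k) * ℕtoℚ (suc k)
      ≡⟨ trans (*-comm (pos 1 / suc k) (ℕtoℚ (suc k))) (n*[1/n]≡1 (suc k)) ⟩
    1ℚ ∎
    where open ≡-Reasoning

  -- Since `X T s r` is a joint probability, the expected cost of the current match is literally the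
  -- LP objective. The continuation after `s` sees `s` alone, so it is averaged uniformly.
  ALG-from-suc : ∀ k T → ∣ T ∣ ≡ suc k →
    ALG-from (suc k) T ≡ objective T (X T) + (pos 1 / suc k) * sumFin (λ s → 𝟙 T s * ALG-from k (T ∖ s))
  ALG-from-suc k T ∣T∣≡ = begin
    ALG-from (suc k) T
      ≡⟨ sum-paths-∷ k T pathCost ⟩
    sumFin (λ r → sumFin (λ s → 𝟙 T s * (X T s r *
      sumVec k (λ rs → sumVec k (λ ss → pathProb (T ∖ s) rs ss * (dist s r + pathCost rs ss))))))
      ≡⟨ ΣF.S-cong (λ r → ΣF.S-cong (λ s → 𝟙*-cong T s (λ s∈T → cong (X T s r *_) (split r s s∈T)))) ⟩
    sumFin (λ r → sumFin (λ s → 𝟙 T s * (X T s r * (dist s r + ALG-from k (T ∖ s)))))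
      ≡⟨ ΣF.S-cong (λ r → trans (ΣF.S-cong (λ s → lem (𝟙 T s) (X T s r) (dist s r) (ALG-from k (T ∖ s))))
           (ΣF.S-+ (λ s → 𝟙 T s * (dist s r * X T s r)) (λ s → 𝟙 T s * (X T s r * ALG-from k (T ∖ s))))) ⟩
    sumFin (λ r → sumFin (λ s → 𝟙 T s * (dist s r * X T s r)) + sumFin (λ s → 𝟙 T s * (X T s r * ALG-from k (T ∖ s))))
      ≡⟨ ΣF.S-+ (λ r → sumFin (λ s → 𝟙 T s * (dist s r * X T s r))) (λ r → sumFin (λ s → 𝟙 T s * (X T s r * ALG-from k (T ∖ s)))) ⟩
    sumFin (λ r → sumFin (λ s → 𝟙 T s * (dist s r * X T s r))) + sumFin (λ r → sumFin (λ s → 𝟙 T s * (X T s r * ALG-from k (T ∖ s))))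
      ≡⟨ cong₂ _+_ first (sum-servers-uniform T ∣T∣≡ (λ s → ALG-from k (T ∖ s))) ⟩
    objective T (X T) + (pos 1 / suc k) * sumFin (λ s → 𝟙 T s * ALG-from k (T ∖ s)) ∎
    where
    open ≡-Reasoning
    lem : ∀ i x d e → i * (x * (d + e)) ≡ i * (d * x) + i * (x * e)
    lem = solve-∀ ℚ-ring
    lem₁ : ∀ p d c → p * (d + c) ≡ d * (p * 1ℚ) + p * c
    lem₁ = solve-∀ ℚ-ring
    first : sumFin (λ r → sumFin (λ s → 𝟙 T s * (dist s r * X T s r))) ≡ objective T (X T)
    first = begin
      sumFin (λ r → sumFin (λ s → 𝟙 T s * (dist s r * X T s r)))
        ≡⟨ ΣF.S-comm-Fin (λ r s → 𝟙 T s * (dist s r * X T s r)) ⟩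
      sumFin (λ s → sumFin (λ r → 𝟙 T s * (dist s r * X T s r)))
        ≡⟨ ΣF.S-cong (λ s → ΣF.S-* (𝟙 T s) (λ r → dist s r * X T s r)) ⟩
      sumFin (λ s → 𝟙 T s * sumFin (λ r → dist s r * X T s r))
        ≡⟨ sumIn≡ T (λ s → sumFin (λ r → dist s r * X T s r)) ⟨
      objective T (X T) ∎
    split : ∀ r s → s ∈ T →
      sumVec k (λ rs → sumVec k (λ ss → pathProb (T ∖ s) rs ss * (dist s r + pathCost rs ss))) ≡ dist s r + ALG-from k (T ∖ s)
    split r s s∈T = begin
      sumVec k (λ rs → sumVec k (λ ss → pathProb (T ∖ s) rs ss * (dist s r + pathCost rs ss)))
        ≡⟨ ΣV.S-cong k (λ rs → trans (ΣV.S-cong k (λ ss → lem₁ (pathProb (T ∖ s) rs ss) (dist s r) (pathCost rs ss)))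
             (trans (ΣV.S-+ k (λ ss → dist s r * (pathProb (T ∖ s) rs ss * 1ℚ)) (λ ss → pathProb (T ∖ s) rs ss * pathCost rs ss))
               (cong (_+ sumVec k (λ ss → pathProb (T ∖ s) rs ss * pathCost rs ss)) (ΣV.S-* k (dist s r) (λ ss → pathProb (T ∖ s) rs ss * 1ℚ))))) ⟩
      sumVec k (λ rs → dist s r * sumVec k (λ ss → pathProb (T ∖ s) rs ss * 1ℚ) + sumVec k (λ ss → pathProb (T ∖ s) rs ss * pathCost rs ss))
        ≡⟨ trans (ΣV.S-+ k (λ rs → dist s r * sumVec k (λ ss → pathProb (T ∖ s) rs ss * 1ℚ)) (λ rs → sumVec k (λ ss → pathProb (T ∖ s) rs ss * pathCost rs ss)))
             (cong (_+ ALG-from k (T ∖ s)) (ΣV.S-* k (dist s r) (λ rs → sumVec k (λ ss → pathProb (T ∖ s) rs ss * 1ℚ)))) ⟩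
      dist s r * sumVec k (λ rs → sumVec k (λ ss → pathProb (T ∖ s) rs ss * 1ℚ)) + ALG-from k (T ∖ s)
        ≡⟨ cong (λ p → dist s r * p + ALG-from k (T ∖ s)) (sum-pathProb k (T ∖ s) (ℕ.suc-injective (trans (sym (∣T∣≡1+∣T∖s∣ s∈T)) ∣T∣≡))) ⟩
      dist s r * 1ℚ + ALG-from k (T ∖ s)
        ≡⟨ cong (_+ ALG-from k (T ∖ s)) (*-identityʳ (dist s r)) ⟩
      dist s r + ALG-from k (T ∖ s) ∎

  -- The expected cost satisfies the recursion of `ALG-from-suc` with equality, and the recursion is
  -- monotone; any supersolution `Φ` therefore dominates it.
  ALG-from-bound : (Φ : ℕ → Subset n → ℚ) → (∀ T → 0ℚ ≤ Φ 0 T) →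
    (∀ k T → ∣ T ∣ ≡ suc k →
      objective T (X T) + (pos 1 / suc k) * sumFin (λ s → 𝟙 T s * Φ k (T ∖ s)) ≤ Φ (suc k) T) →
    ∀ k T → ∣ T ∣ ≡ k → ALG-from k T ≤ Φ k T
  ALG-from-bound Φ base step zero    T ∣T∣≡ = ≤-trans (≤-reflexive (*-zeroʳ 1ℚ)) (base T)
  ALG-from-bound Φ base step (suc k) T ∣T∣≡ = begin
    ALG-from (suc k) T
      ≡⟨ ALG-from-suc k T ∣T∣≡ ⟩
    objective T (X T) + (pos 1 / suc k) * sumFin (λ s → 𝟙 T s * ALG-from k (T ∖ s))
      ≤⟨ +-monoʳ-≤ (objective T (X T)) (*-mono-nonneg (0≤1/n (suc k)) (ΣF.S-mono (λ s → 𝟙*-mono T s (λ s∈T →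
           ALG-from-bound Φ base step k (T ∖ s) (ℕ.suc-injective (trans (sym (∣T∣≡1+∣T∖s∣ s∈T)) ∣T∣≡)))))) ⟩
    objective T (X T) + (pos 1 / suc k) * sumFin (λ s → 𝟙 T s * Φ k (T ∖ s))
      ≤⟨ step k T ∣T∣≡ ⟩
    Φ (suc k) T ∎
    where open ≤-Reasoning

-- Trees and their metrics

δ : ∀ {n} → Fin n → Fin n → ℚ
δ i j with i ≟ j
... | yes _ = 1ℚ
... | no  _ = 0ℚ

δ-≢ : ∀ {n} {i j : Fin n} → i ≢ j → δ i j ≡ 0ℚ
δ-≢ {i = i} {j} i≢j with i ≟ j
... | yes i≡j = contradiction i≡j i≢j
... | no  _   = refl

δ-01 : ∀ {n} (i j : Fin n) → δ i j ≡ 0ℚ ⊎ δ i j ≡ 1ℚ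
δ-01 i j with i ≟ j
... | yes _ = inj₂ refl
... | no  _ = inj₁ refl

0≤δ : ∀ {n} (i j : Fin n) → 0ℚ ≤ δ i j
0≤δ i j with i ≟ j
... | yes _ = nonNegative⁻¹ 1ℚ
... | no  _ = ≤-refl

δ-cong : ∀ {n} {i j : Fin n} (f : Fin n → ℚ) → δ i j * f i ≡ δ i j * f j
δ-cong {i = i} {j} f with i ≟ j
... | yes refl = refl
... | no  _    = trans (*-zeroˡ (f i)) (sym (*-zeroˡ (f j)))

δ-suc : ∀ {n} (i j : Fin n) → δ (suc i) (suc j) ≡ δ i j
δ-suc i j with i ≟ j
... | yes _ = refl
... | no  _ = refl

sum-δ : ∀ {n} (f : Fin n → ℚ) i → sumFin (λ j → f j * δ i j) ≡ f i
sum-δ {suc n} f zero = begin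
  f zero * 1ℚ + sumFin (λ j → f (suc j) * 0ℚ)  ≡⟨ cong₂ _+_ (*-identityʳ (f zero)) (trans (ΣF.S-cong {n} (λ j → *-zeroʳ (f (suc j)))) (ΣF.S-0 {n})) ⟩
  f zero + 0ℚ                                  ≡⟨ +-identityʳ (f zero) ⟩
  f zero                                       ∎
  where open ≡-Reasoning
sum-δ {suc n} f (suc i) = begin
  f zero * 0ℚ + sumFin (λ j → f (suc j) * δ (suc i) (suc j))
    ≡⟨ cong₂ _+_ (*-zeroʳ (f zero)) (ΣF.S-cong (λ j → cong (f (suc j) *_) (δ-suc i j))) ⟩
  0ℚ + sumFin (λ j → f (suc j) * δ i j)
    ≡⟨ trans (+-identityˡ (sumFin (λ j → f (suc j) * δ i j))) (sum-δ (f ∘ suc) i) ⟩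
  f (suc i) ∎
  where open ≡-Reasoning

term≤sum : ∀ {n} (f : Fin n → ℚ) → (∀ i → 0ℚ ≤ f i) → ∀ i → f i ≤ sumFin f
term≤sum {suc n} f 0≤f zero    = ≤-by-gap (sumFin (f ∘ suc)) (ΣF.S-nonneg (0≤f ∘ suc)) refl
term≤sum {suc n} f 0≤f (suc i) =
  ≤-trans (term≤sum (f ∘ suc) (0≤f ∘ suc) i) (≤-by-gap (f zero) (0≤f zero) (+-comm (f zero) (sumFin (f ∘ suc))))

module TreeMetric {m : ℕ} (t : Tree m) (d : Fin (suc m) → Fin (suc m) → ℚ) (metric : IsShortestPathMetric t d) where
  open Tree t

  -- The first argument is fuel: parents have smaller indices, so toℕ v steps reach the root from v.
  private
    χ′ : ℕ → Fin m → Fin (suc m) → ℚ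
    χ′ _       e zero    = 0ℚ
    χ′ zero    e (suc i) = 0ℚ
    χ′ (suc f) e (suc i) = δ i e + χ′ f e (par i)

    χ′-fuel : ∀ f g e v → toℕ v ℕ.≤ f → toℕ v ℕ.≤ g → χ′ f e v ≡ χ′ g e v
    χ′-fuel f       g       e zero    _         _         = refl
    χ′-fuel (suc f) (suc g) e (suc i) (s≤s i≤f) (s≤s i≤g) =
      cong (δ i e +_) (χ′-fuel f g e (par i) (ℕ.≤-trans (par< i) i≤f) (ℕ.≤-trans (par< i) i≤g))

    χ′-above : ∀ f e v → toℕ v ℕ.≤ toℕ e → χ′ f e v ≡ 0ℚ
    χ′-above f       e zero    _   = refl
    χ′-above zero    e (suc i) _   = refl
    χ′-above (suc f) e (suc i) i<e =
      cong₂ _+_ (δ-≢ (λ i≡e → ℕ.<⇒≢ i<e (cong toℕ i≡e))) (χ′-above f e (par i) (ℕ.≤-trans (par< i) (ℕ.<⇒≤ i<e)))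

    -- Indices decrease on the way to the root: once the path has crossed `e` it stays at indices at
    -- most `toℕ e`, so `e` is not counted a second time.
    χ′-01 : ∀ f e v → χ′ f e v ≡ 0ℚ ⊎ χ′ f e v ≡ 1ℚ
    χ′-01 f       e zero    = inj₁ refl
    χ′-01 zero    e (suc i) = inj₁ refl
    χ′-01 (suc f) e (suc i) with i ≟ e
    ... | yes refl = inj₂ (cong (1ℚ +_) (χ′-above f e (par e) (par< e)))
    ... | no  _ with χ′-01 f e (par i)
    ...   | inj₁ eq = inj₁ (cong (0ℚ +_) eq)
    ...   | inj₂ eq = inj₂ (cong (0ℚ +_) eq)

  χ : Fin m → Fin (suc m) → ℚ
  χ = χ′ m

  χ-suc : ∀ e i → χ e (suc i) ≡ δ i e + χ e (par i)
  χ-suc e i = χ′-fuel m (suc m) e (suc i) (toℕ<n i) (ℕ.m≤n⇒m≤1+n (toℕ<n i))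

  χ-above : ∀ e v → toℕ v ℕ.≤ toℕ e → χ e v ≡ 0ℚ
  χ-above = χ′-above m

  χ-01 : ∀ e v → χ e v ≡ 0ℚ ⊎ χ e v ≡ 1ℚ
  χ-01 = χ′-01 m

  treeCost : (Fin m → ℚ) → ℚ
  treeCost f = sumFin (λ e → len e * abs (f e))

  private
    treeCost-δ : ∀ i → sumFin (λ e → len e * abs (δ i e)) ≡ len i
    treeCost-δ i = trans (ΣF.S-cong (λ e → cong (len e *_) (0≤p⇒∣p∣≡p (0≤δ i e)))) (sum-δ len i)

    treeCost-+ : ∀ f g → treeCost (λ e → f e + g e) ≤ treeCost f + treeCost g
    treeCost-+ f g = ≤-trans
      (ΣF.S-mono (λ e → ≤-trans (*-mono-nonneg (len≥0 e) (∣p+q∣≤∣p∣+∣q∣ (f e) (g e)))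
        (≤-reflexive (*-distribˡ-+ (len e) (abs (f e)) (abs (g e))))))
      (≤-reflexive (ΣF.S-+ (λ e → len e * abs (f e)) (λ e → len e * abs (g e))))

    treeCost-cong : ∀ {f g} → (∀ e → f e ≡ g e) → treeCost f ≡ treeCost g
    treeCost-cong h = ΣF.S-cong (λ e → cong (λ x → len e * abs x) (h e))

    treeCost-neg : ∀ f → treeCost (λ e → - f e) ≡ treeCost f
    treeCost-neg f = ΣF.S-cong (λ e → cong (len e *_) (∣-p∣≡∣p∣ (f e)))

  -- Crossing the edge `i` changes `χ i` by one and no other `χ e`, so every edge whose ends are
  -- separated has been paid for at least once.
  treeCost≤walkLength : ∀ {u v} (w : Walk t u v) → treeCost (λ e → χ e u - χ e v) ≤ walkLength t w
  treeCost≤walkLength {u} stop = ≤-reflexive (begin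
    sumFin (λ e → len e * abs (χ e u - χ e u))  ≡⟨ ΣF.S-cong (λ e → trans (cong (λ x → len e * abs x) (+-inverseʳ (χ e u))) (*-zeroʳ (len e))) ⟩
    sumFin {m} (λ _ → 0ℚ)                       ≡⟨ ΣF.S-0 {m} ⟩
    0ℚ                                          ∎)
    where open ≡-Reasoning
  treeCost≤walkLength {v = v} (up i w) = begin
    treeCost (λ e → χ e (suc i) - χ e v)          ≡⟨ treeCost-cong (λ e → trans (cong (_- χ e v) (χ-suc e i)) (+-assoc (δ i e) (χ e (par i)) (- χ e v))) ⟩
    treeCost (λ e → δ i e + (χ e (par i) - χ e v)) ≤⟨ treeCost-+ (λ e → δ i e) (λ e → χ e (par i) - χ e v) ⟩
    treeCost (λ e → δ i e) + treeCost (λ e → χ e (par i) - χ e v) ≤⟨ +-mono-≤ (≤-reflexive (treeCost-δ i)) (treeCost≤walkLength w) ⟩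
    len i + walkLength t w ∎
    where open ≤-Reasoning
  treeCost≤walkLength {v = v} (down i w) = begin
    treeCost (λ e → χ e (par i) - χ e v)          ≡⟨ treeCost-cong (λ e → trans (lem (χ e (par i)) (δ i e) (χ e v)) (cong (λ x → - δ i e + (x - χ e v)) (sym (χ-suc e i)))) ⟩
    treeCost (λ e → - δ i e + (χ e (suc i) - χ e v)) ≤⟨ treeCost-+ (λ e → - δ i e) (λ e → χ e (suc i) - χ e v) ⟩
    treeCost (λ e → - δ i e) + treeCost (λ e → χ e (suc i) - χ e v) ≤⟨ +-mono-≤ (≤-reflexive (trans (treeCost-neg (λ e → δ i e)) (treeCost-δ i))) (treeCost≤walkLength w) ⟩
    len i + walkLength t w ∎
    where
    open ≤-Reasoning
    lem : ∀ p a v → p - v ≡ - a + ((a + p) - v)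
    lem = solve-∀ ℚ-ring

  treeCost≤d : ∀ u v → treeCost (λ e → χ e u - χ e v) ≤ d u v
  treeCost≤d u v with proj₁ (metric u v)
  ... | w , w≡d = subst (treeCost (λ e → χ e u - χ e v) ≤_) w≡d (treeCost≤walkLength w)

  private
    _++ʷ_ : ∀ {u v w} → Walk t u v → Walk t v w → Walk t u w
    stop     ++ʷ q = q
    up i p   ++ʷ q = up i (p ++ʷ q)
    down i p ++ʷ q = down i (p ++ʷ q)

    length-++ʷ : ∀ {u v w} (p : Walk t u v) (q : Walk t v w) → walkLength t (p ++ʷ q) ≡ walkLength t p + walkLength t q
    length-++ʷ stop       q = sym (+-identityˡ (walkLength t q))
    length-++ʷ (up i p)   q = trans (cong (len i +_) (length-++ʷ p q)) (sym (+-assoc (len i) (walkLength t p) (walkLength t q)))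
    length-++ʷ (down i p) q = trans (cong (len i +_) (length-++ʷ p q)) (sym (+-assoc (len i) (walkLength t p) (walkLength t q)))

  d-triangle : ∀ u v w → d u w ≤ d u v + d v w
  d-triangle u v w with proj₁ (metric u v) | proj₁ (metric v w)
  ... | p , p≡d | q , q≡d = ≤-trans (proj₂ (metric u w) (p ++ʷ q)) (≤-reflexive (trans (length-++ʷ p q) (cong₂ _+_ p≡d q≡d)))

  d-self : ∀ v → d v v ≤ 0ℚ
  d-self v = proj₂ (metric v v) stop

  toPar : Fin m → Fin (suc m) → Fin (suc m)
  toPar e v with v ≟ suc e
  ... | yes _ = par e
  ... | no  _ = v

  d-toParˡ : ∀ e u v → d u v ≤ len e * δ u (suc e) + d (toPar e u) v
  d-toParˡ e u v with u ≟ suc e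
  ... | yes refl = ≤-trans (d-triangle (suc e) (par e) v) (+-monoˡ-≤ (d (par e) v)
                     (≤-trans (proj₂ (metric (suc e) (par e)) (up e stop)) (≤-reflexive (lem (len e)))))
    where
    lem : ∀ x → x + 0ℚ ≡ x * 1ℚ
    lem = solve-∀ ℚ-ring
  ... | no _ = ≤-reflexive (sym (lem (len e) (d u v)))
    where
    lem : ∀ x y → x * 0ℚ + y ≡ y
    lem = solve-∀ ℚ-ring

  d-toParʳ : ∀ e u v → d u v ≤ len e * δ v (suc e) + d u (toPar e v)
  d-toParʳ e u v with v ≟ suc e
  ... | yes refl = ≤-trans (d-triangle u (par e) (suc e)) (≤-trans (+-monoʳ-≤ (d u (par e))
                     (≤-trans (proj₂ (metric (par e) (suc e)) (down e stop)) (≤-reflexive (lem (len e)))))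
                     (≤-reflexive (+-comm (d u (par e)) (len e * 1ℚ))))
    where
    lem : ∀ x → x + 0ℚ ≡ x * 1ℚ
    lem = solve-∀ ℚ-ring
  ... | no _ = ≤-reflexive (sym (lem (len e) (d u v)))
    where
    lem : ∀ x y → x * 0ℚ + y ≡ y
    lem = solve-∀ ℚ-ring

  χ-toPar : ∀ e e′ v → χ e′ v ≡ δ e e′ * δ v (suc e) + χ e′ (toPar e v)
  χ-toPar e e′ v with v ≟ suc e
  ... | yes refl = trans (χ-suc e′ e) (cong (_+ χ e′ (par e)) (sym (*-identityʳ (δ e e′))))
  ... | no  _    = sym (lem (δ e e′) (χ e′ v))
    where
    lem : ∀ x y → x * 0ℚ + y ≡ y
    lem = solve-∀ ℚ-ring

  δ-χ-toPar : ∀ e e′ v → δ v (suc e) * χ e′ (toPar e v) ≡ δ v (suc e) * χ e′ (par e)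
  δ-χ-toPar e e′ v with v ≟ suc e
  ... | yes refl = refl
  ... | no  _    = trans (*-zeroˡ (χ e′ v)) (sym (*-zeroˡ (χ e′ (par e))))

  toPar-≤ : ∀ e v → toℕ v ℕ.≤ suc (toℕ e) → toℕ (toPar e v) ℕ.≤ toℕ e
  toPar-≤ e v v≤ with v ≟ suc e
  ... | yes _  = par< e
  ... | no v≢e = ℕ.≤-pred (ℕ.≤∧≢⇒< v≤ (λ eq → v≢e (toℕ-injective eq)))

-- Transport plans on trees

inverse : ∀ {p} → 0ℚ < p → Σ ℚ λ r → (0ℚ ≤ r) × (r * p ≡ 1ℚ)
inverse {p} 0<p = 1/p , <⇒≤ (positive⁻¹ 1/p {{1/pos⇒pos p {{positive 0<p}}}}) , *-inverseˡ p {{>-nonZero 0<p}}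
  where
  1/p : ℚ
  1/p = (1/ p) {{>-nonZero 0<p}}

-- ρ = 1 / max(M , N), with the junk value 0 when M = N = 0.
cancelRatio : ∀ {M N} → 0ℚ ≤ M → 0ℚ ≤ N →
  Σ ℚ λ ρ → (0ℚ ≤ ρ) × (0ℚ ≤ 1ℚ - ρ * N) × (0ℚ ≤ 1ℚ - ρ * M) ×
            (M * (1ℚ - ρ * N) + N * (1ℚ - ρ * M) ≡ abs (M - N))
cancelRatio {M} {N} 0≤M 0≤N with ≤-total M N | <-cmp 0ℚ M | <-cmp 0ℚ N
... | inj₂ N≤M | tri< 0<M _ _ | _ with inverse 0<M
...   | ρ , 0≤ρ , ρM≡1 = ρ , 0≤ρ ,
  subst (0ℚ ≤_) (trans (lem₁ ρ M N) (cong (_- ρ * N) ρM≡1)) (*-nonneg 0≤ρ (p≤q⇒0≤q-p N≤M)) ,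
  subst (0ℚ ≤_) (trans (sym (+-inverseʳ 1ℚ)) (cong (λ w → 1ℚ - w) (sym ρM≡1))) ≤-refl ,
  trans (lem₂ ρ M N) (trans (cong (λ x → M + N - (x * N + x * N)) ρM≡1) (trans (lem₃ M N) (sym (0≤p⇒∣p∣≡p (p≤q⇒0≤q-p N≤M)))))
  where
  lem₁ : ∀ ρ M N → ρ * (M - N) ≡ ρ * M - ρ * N
  lem₁ = solve-∀ ℚ-ring
  lem₂ : ∀ ρ M N → M * (1ℚ - ρ * N) + N * (1ℚ - ρ * M) ≡ M + N - ((ρ * M) * N + (ρ * M) * N)
  lem₂ = solve-∀ ℚ-ring
  lem₃ : ∀ M N → M + N - (1ℚ * N + 1ℚ * N) ≡ M - N
  lem₃ = solve-∀ ℚ-ring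
cancelRatio {M} {N} 0≤M 0≤N | inj₁ M≤N | _ | tri< 0<N _ _ with inverse 0<N
...   | ρ , 0≤ρ , ρN≡1 = ρ , 0≤ρ ,
  subst (0ℚ ≤_) (trans (sym (+-inverseʳ 1ℚ)) (cong (λ w → 1ℚ - w) (sym ρN≡1))) ≤-refl ,
  subst (0ℚ ≤_) (trans (lem₁ ρ M N) (cong (_- ρ * M) ρN≡1)) (*-nonneg 0≤ρ (p≤q⇒0≤q-p M≤N)) ,
  trans (lem₂ ρ M N) (trans (cong (λ x → M + N - (x * M + x * M)) ρN≡1) (trans (lem₃ M N)
    (trans (sym (0≤p⇒∣p∣≡p (p≤q⇒0≤q-p M≤N))) (trans (sym (∣-p∣≡∣p∣ (N - M))) (cong abs (lem₄ M N))))))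
  where
  lem₁ : ∀ ρ M N → ρ * (N - M) ≡ ρ * N - ρ * M
  lem₁ = solve-∀ ℚ-ring
  lem₂ : ∀ ρ M N → M * (1ℚ - ρ * N) + N * (1ℚ - ρ * M) ≡ M + N - ((ρ * N) * M + (ρ * N) * M)
  lem₂ = solve-∀ ℚ-ring
  lem₃ : ∀ M N → M + N - (1ℚ * M + 1ℚ * M) ≡ N - M
  lem₃ = solve-∀ ℚ-ring
  lem₄ : ∀ M N → - (N - M) ≡ M - N
  lem₄ = solve-∀ ℚ-ring
cancelRatio {M} {N} 0≤M 0≤N | inj₂ N≤M | tri≈ _ refl _ | _ rewrite ≤-antisym N≤M 0≤N =
  0ℚ , ≤-refl , nonNegative⁻¹ 1ℚ , nonNegative⁻¹ 1ℚ , refl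
cancelRatio {M} {N} 0≤M 0≤N | inj₁ M≤N | _ | tri≈ _ refl _ rewrite ≤-antisym M≤N 0≤M =
  0ℚ , ≤-refl , nonNegative⁻¹ 1ℚ , nonNegative⁻¹ 1ℚ , refl
cancelRatio {M} {N} 0≤M 0≤N | inj₂ _ | tri> _ _ M<0 | _ = contradiction (<-≤-trans M<0 0≤M) (<-irrefl refl)
cancelRatio {M} {N} 0≤M 0≤N | inj₁ _ | _ | tri> _ _ N<0 = contradiction (<-≤-trans N<0 0≤N) (<-irrefl refl)

-- As functions of `e′` the two summands of `F` have disjoint supports, so here the absolute value
-- is additive.
weighted-abs-split : ∀ {m} (e e′ : Fin m) l a {F f} → F ≡ δ e e′ * a + f → (e ≡ e′ → f ≡ 0ℚ) →
  l * abs F ≡ l * abs a * δ e e′ + l * abs f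
weighted-abs-split e e′ l a {f = f} refl f≡0 with e ≟ e′
... | no _ = trans (cong (λ w → l * abs w) (lem₀ a f)) (lem₁ l (abs a) (abs f))
  where
  lem₀ : ∀ a f → 0ℚ * a + f ≡ f
  lem₀ = solve-∀ ℚ-ring
  lem₁ : ∀ l a f → l * f ≡ l * a * 0ℚ + l * f
  lem₁ = solve-∀ ℚ-ring
... | yes e≡e′ rewrite f≡0 e≡e′ = trans (cong (λ w → l * abs w) (lem₀ a)) (lem₁ l (abs a))
  where
  lem₀ : ∀ a → 1ℚ * a + 0ℚ ≡ a
  lem₀ = solve-∀ ℚ-ring
  lem₁ : ∀ l a → l * a ≡ l * a * 1ℚ + l * 0ℚ
  lem₁ = solve-∀ ℚ-ring

IsPlan : ∀ {n} → (Fin n → ℚ) → (Fin n → ℚ) → (Fin n → Fin n → ℚ) → Set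
IsPlan μ ν x = (∀ i j → 0ℚ ≤ x i j) × (∀ i → sumFin (x i) ≡ μ i) × (∀ j → sumFin (λ i → x i j) ≡ ν j)

module Transport {m : ℕ} (t : Tree m) (d : Fin (suc m) → Fin (suc m) → ℚ) (metric : IsShortestPathMetric t d) {n : ℕ} where
  open Tree t
  open TreeMetric t d metric

  mass : (Fin n → ℚ) → (Fin n → Fin (suc m)) → Fin m → ℚ
  mass μ src e = sumFin (λ i → μ i * χ e (src i))

  cost : (src tgt : Fin n → Fin (suc m)) → (Fin n → Fin n → ℚ) → ℚ
  cost src tgt x = sumFin (λ i → sumFin (λ j → d (src i) (tgt j) * x i j))

  private
    -- Parents have smaller indices, so the vertices 0, ..., b span a subtree in which b, if
    -- positive, is a leaf. The induction on `b` removes this leaf.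
    Claim : ℕ → Set
    Claim b = ∀ μ ν (src tgt : Fin n → Fin (suc m)) →
      (∀ i → 0ℚ ≤ μ i) → (∀ j → 0ℚ ≤ ν j) → sumFin μ ≡ sumFin ν →
      (∀ i → toℕ (src i) ℕ.≤ b) → (∀ j → toℕ (tgt j) ℕ.≤ b) →
      Σ (Fin n → Fin n → ℚ) λ x → IsPlan μ ν x × (cost src tgt x ≤ treeCost (λ e → mass μ src e - mass ν tgt e))

    0≤treeCost : ∀ f → 0ℚ ≤ treeCost f
    0≤treeCost f = ΣF.S-nonneg (λ e → *-nonneg (len≥0 e) (0≤∣p∣ (f e)))

    -- With all positions at the root every plan is free, and the product plan has the right margins
    -- once normalised. `cancelRatio` at equal totals supplies the factor and also covers total mass
    -- zero, where its junk value gives the zero plan.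
    at-root : Claim 0
    at-root μ ν src tgt 0≤μ 0≤ν Σμ≡Σν src≤ tgt≤ with cancelRatio (ΣF.S-nonneg 0≤μ) (ΣF.S-nonneg 0≤ν)
    ... | ρ , 0≤ρ , 0≤1-ρN , 0≤1-ρM , total = x , (0≤x , row , column) , ≤-trans cost≤0 (0≤treeCost (λ e → mass μ src e - mass ν tgt e))
      where
      M = sumFin μ
      N = sumFin ν
      x : Fin n → Fin n → ℚ
      x i j = (ρ * μ i) * ν j
      0≤x : ∀ i j → 0ℚ ≤ x i j
      0≤x i j = *-nonneg (*-nonneg 0≤ρ (0≤μ i)) (0≤ν j)
      nothing-left : M * (1ℚ - ρ * N) + N * (1ℚ - ρ * M) ≡ 0ℚ
      nothing-left = trans total (cong abs (trans (cong (λ w → M - w) (sym Σμ≡Σν)) (+-inverseʳ M)))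
      -- Turns `nothing-left`, a statement about totals, into one about each row and each column:
      -- nonnegative terms with a nonpositive sum are all zero.
      vanish : ∀ (f : Fin n → ℚ) c → (∀ i → 0ℚ ≤ f i) → 0ℚ ≤ c → sumFin f * c ≤ 0ℚ → ∀ i → f i * c ≡ 0ℚ
      vanish f c 0≤f 0≤c h i = ≤-antisym
        (≤-trans (term≤sum (λ i → f i * c) (λ i → *-nonneg (0≤f i) 0≤c) i) (≤-trans (≤-reflexive (ΣF.S-*ʳ f c)) h))
        (*-nonneg (0≤f i) 0≤c)
      row : ∀ i → sumFin (x i) ≡ μ i
      row i = begin
        sumFin (λ j → (ρ * μ i) * ν j)        ≡⟨ ΣF.S-* (ρ * μ i) ν ⟩
        (ρ * μ i) * N                         ≡⟨ lem ρ (μ i) N ⟩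
        μ i - μ i * (1ℚ - ρ * N)              ≡⟨ cong (λ w → μ i - w) (vanish μ (1ℚ - ρ * N) 0≤μ 0≤1-ρN (≤-trans (≤-by-gap (N * (1ℚ - ρ * M)) (*-nonneg (ΣF.S-nonneg 0≤ν) 0≤1-ρM) refl) (≤-reflexive nothing-left)) i) ⟩
        μ i - 0ℚ                              ≡⟨ +-identityʳ (μ i) ⟩
        μ i                                   ∎
        where
        open ≡-Reasoning
        lem : ∀ ρ a N → (ρ * a) * N ≡ a - a * (1ℚ - ρ * N)
        lem = solve-∀ ℚ-ring
      column : ∀ j → sumFin (λ i → x i j) ≡ ν j
      column j = begin
        sumFin (λ i → (ρ * μ i) * ν j)        ≡⟨ trans (ΣF.S-*ʳ (λ i → ρ * μ i) (ν j)) (cong (_* ν j) (ΣF.S-* ρ μ)) ⟩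
        (ρ * M) * ν j                         ≡⟨ lem ρ (ν j) M ⟩
        ν j - ν j * (1ℚ - ρ * M)              ≡⟨ cong (λ w → ν j - w) (vanish ν (1ℚ - ρ * M) 0≤ν 0≤1-ρM (≤-trans (≤-by-gap (M * (1ℚ - ρ * N)) (*-nonneg (ΣF.S-nonneg 0≤μ) 0≤1-ρN) (+-comm (M * (1ℚ - ρ * N)) (N * (1ℚ - ρ * M)))) (≤-reflexive nothing-left)) j) ⟩
        ν j - 0ℚ                              ≡⟨ +-identityʳ (ν j) ⟩
        ν j                                   ∎
        where
        open ≡-Reasoning
        lem : ∀ ρ a M → (ρ * M) * a ≡ a - a * (1ℚ - ρ * M)
        lem = solve-∀ ℚ-ring
      d≤0 : ∀ u v → toℕ u ℕ.≤ 0 → toℕ v ℕ.≤ 0 → d u v ≤ 0ℚ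
      d≤0 zero zero _ _ = d-self zero
      cost≤0 : cost src tgt x ≤ 0ℚ
      cost≤0 = ≤-trans (ΣF.S-mono (λ i → ΣF.S-mono (λ j →
          ≤-trans (≤-reflexive (*-comm (d (src i) (tgt j)) (x i j)))
            (≤-trans (*-mono-nonneg (0≤x i j) (d≤0 (src i) (tgt j) (src≤ i) (tgt≤ j))) (≤-reflexive (*-zeroʳ (x i j)))))))
        (≤-reflexive (trans (ΣF.S-cong {n} (λ _ → ΣF.S-0 {n})) (ΣF.S-0 {n})))

    -- Elimination of the leaf `suc e`: supply and demand present there are matched with each other
    -- as far as possible, at no cost, and the excess of the larger side crosses `e` to the parent.
    module PushUp (e : Fin m) (μ ν : Fin n → ℚ) (src tgt : Fin n → Fin (suc m))
      (0≤μ : ∀ i → 0ℚ ≤ μ i) (0≤ν : ∀ j → 0ℚ ≤ ν j)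
      (src≤ : ∀ i → toℕ (src i) ℕ.≤ suc (toℕ e)) (tgt≤ : ∀ j → toℕ (tgt j) ℕ.≤ suc (toℕ e)) where

      at : (Fin n → Fin (suc m)) → Fin n → ℚ
      at loc i = δ (loc i) (suc e)

      here-mass : (Fin n → ℚ) → (Fin n → Fin (suc m)) → ℚ
      here-mass κ loc = sumFin (λ i → at loc i * κ i)

      M = here-mass μ src
      N = here-mass ν tgt

      0≤here-mass : ∀ κ loc → (∀ i → 0ℚ ≤ κ i) → 0ℚ ≤ here-mass κ loc
      0≤here-mass κ loc 0≤κ = ΣF.S-nonneg (λ i → *-nonneg (0≤δ (loc i) (suc e)) (0≤κ i))

      rest : (Fin n → ℚ) → (Fin n → Fin (suc m)) → ℚ → Fin n → ℚ
      rest κ loc c i = κ i - (at loc i * κ i) * c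

      0≤rest : ∀ κ loc c → (∀ i → 0ℚ ≤ κ i) → 0ℚ ≤ 1ℚ - c → ∀ i → 0ℚ ≤ rest κ loc c i
      0≤rest κ loc c 0≤κ 0≤1-c i with δ-01 (loc i) (suc e)
      ... | inj₁ eq rewrite eq = subst (0ℚ ≤_) (lem (κ i) c) (0≤κ i)
        where
        lem : ∀ k c → k ≡ k - (0ℚ * k) * c
        lem = solve-∀ ℚ-ring
      ... | inj₂ eq rewrite eq = subst (0ℚ ≤_) (lem (κ i) c) (*-nonneg (0≤κ i) 0≤1-c)
        where
        lem : ∀ k c → k * (1ℚ - c) ≡ k - (1ℚ * k) * c
        lem = solve-∀ ℚ-ring

      sum-rest : ∀ κ loc c → sumFin (rest κ loc c) ≡ sumFin κ - here-mass κ loc * c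
      sum-rest κ loc c = trans (ΣF.S-- κ (λ i → (at loc i * κ i) * c)) (cong (λ w → sumFin κ - w) (ΣF.S-*ʳ (λ i → at loc i * κ i) c))

      at-rest : ∀ κ loc c → sumFin (λ i → at loc i * rest κ loc c i) ≡ here-mass κ loc * (1ℚ - c)
      at-rest κ loc c = trans (ΣF.S-cong pointwise) (ΣF.S-*ʳ (λ i → at loc i * κ i) (1ℚ - c))
        where
        lem₀ : ∀ k c → 0ℚ * (k - (0ℚ * k) * c) ≡ (0ℚ * k) * (1ℚ - c)
        lem₀ = solve-∀ ℚ-ring
        lem₁ : ∀ k c → 1ℚ * (k - (1ℚ * k) * c) ≡ (1ℚ * k) * (1ℚ - c)
        lem₁ = solve-∀ ℚ-ring
        pointwise : ∀ i → at loc i * rest κ loc c i ≡ (at loc i * κ i) * (1ℚ - c)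
        pointwise i with δ-01 (loc i) (suc e)
        ... | inj₁ eq rewrite eq = lem₀ (κ i) c
        ... | inj₂ eq rewrite eq = lem₁ (κ i) c

      -- Moving mass from `suc e` to its parent affects the edge `e` only. The cancelled mass is
      -- booked at `par e`; it amounts to M (ρ N) for the supply and N (ρ M) for the demand, so it
      -- drops out of their difference.
      mass-split : ∀ κ loc c e′ →
        mass κ loc e′ ≡ δ e e′ * here-mass κ loc + (mass (rest κ loc c) (toPar e ∘ loc) e′ + (here-mass κ loc * c) * χ e′ (par e))
      mass-split κ loc c e′ = begin
        sumFin (λ i → κ i * χ e′ (loc i))
          ≡⟨ ΣF.S-cong pointwise ⟩
        sumFin (λ i → δ e e′ * (at loc i * κ i) + (rest κ loc c i * χ e′ (toPar e (loc i)) + ((at loc i * κ i) * c) * χ e′ (par e)))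
          ≡⟨ ΣF.S-+ (λ i → δ e e′ * (at loc i * κ i)) (λ i → rest κ loc c i * χ e′ (toPar e (loc i)) + ((at loc i * κ i) * c) * χ e′ (par e)) ⟩
        sumFin (λ i → δ e e′ * (at loc i * κ i)) + sumFin (λ i → rest κ loc c i * χ e′ (toPar e (loc i)) + ((at loc i * κ i) * c) * χ e′ (par e))
          ≡⟨ cong₂ _+_ (ΣF.S-* (δ e e′) (λ i → at loc i * κ i))
               (trans (ΣF.S-+ (λ i → rest κ loc c i * χ e′ (toPar e (loc i))) (λ i → ((at loc i * κ i) * c) * χ e′ (par e)))
                 (cong (mass (rest κ loc c) (toPar e ∘ loc) e′ +_)
                   (trans (ΣF.S-*ʳ (λ i → (at loc i * κ i) * c) (χ e′ (par e))) (cong (_* χ e′ (par e)) (ΣF.S-*ʳ (λ i → at loc i * κ i) c))))) ⟩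
        δ e e′ * here-mass κ loc + (mass (rest κ loc c) (toPar e ∘ loc) e′ + (here-mass κ loc * c) * χ e′ (par e)) ∎
        where
        open ≡-Reasoning
        lem : ∀ k a s c y z → s * y ≡ s * z → k * (a * s + y) ≡ a * (s * k) + ((k - (s * k) * c) * y + ((s * k) * c) * z)
        lem k a s c y z h = trans (lem₁ k a s c y) (trans (cong (λ w → a * (s * k) + ((k - (s * k) * c) * y + (k * c) * w)) h) (lem₂ k a s c y z))
          where
          lem₁ : ∀ k a s c y → k * (a * s + y) ≡ a * (s * k) + ((k - (s * k) * c) * y + (k * c) * (s * y))
          lem₁ = solve-∀ ℚ-ring
          lem₂ : ∀ k a s c y z → a * (s * k) + ((k - (s * k) * c) * y + (k * c) * (s * z)) ≡ a * (s * k) + ((k - (s * k) * c) * y + ((s * k) * c) * z)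
          lem₂ = solve-∀ ℚ-ring
        pointwise : ∀ i → κ i * χ e′ (loc i) ≡ δ e e′ * (at loc i * κ i) + (rest κ loc c i * χ e′ (toPar e (loc i)) + ((at loc i * κ i) * c) * χ e′ (par e))
        pointwise i = trans (cong (κ i *_) (χ-toPar e e′ (loc i)))
          (lem (κ i) (δ e e′) (at loc i) c (χ e′ (toPar e (loc i))) (χ e′ (par e)) (δ-χ-toPar e e′ (loc i)))

      mass-pushed : ∀ κ loc → (∀ i → toℕ (loc i) ℕ.≤ suc (toℕ e)) → mass κ (toPar e ∘ loc) e ≡ 0ℚ
      mass-pushed κ loc loc≤ = trans (ΣF.S-cong (λ i → trans (cong (κ i *_) (χ-above e (toPar e (loc i)) (toPar-≤ e (loc i) (loc≤ i)))) (*-zeroʳ (κ i)))) (ΣF.S-0 {n})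

      extend : ∀ ρ → 0ℚ ≤ ρ → M * (1ℚ - ρ * N) + N * (1ℚ - ρ * M) ≡ abs (M - N) →
        ∀ x → IsPlan (rest μ src (ρ * N)) (rest ν tgt (ρ * M)) x →
        cost (toPar e ∘ src) (toPar e ∘ tgt) x ≤ treeCost (λ e′ → mass (rest μ src (ρ * N)) (toPar e ∘ src) e′ - mass (rest ν tgt (ρ * M)) (toPar e ∘ tgt) e′) →
        Σ (Fin n → Fin n → ℚ) λ y → IsPlan μ ν y × (cost src tgt y ≤ treeCost (λ e′ → mass μ src e′ - mass ν tgt e′))
      extend ρ 0≤ρ gap x (0≤x , row , column) cost-x = y , (0≤y , row-y , column-y) , cost-y
        where
        μ′ = rest μ src (ρ * N)
        ν′ = rest ν tgt (ρ * M)
        -- The product of the supply and the demand at `suc e`, scaled by ρ = 1 / max(M , N), uses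
        -- up the smaller side completely and spreads it proportionally over the larger.
        z : Fin n → Fin n → ℚ
        z i j = (ρ * (at src i * μ i)) * (at tgt j * ν j)
        y : Fin n → Fin n → ℚ
        y i j = z i j + x i j
        0≤z : ∀ i j → 0ℚ ≤ z i j
        0≤z i j = *-nonneg (*-nonneg 0≤ρ (*-nonneg (0≤δ (src i) (suc e)) (0≤μ i))) (*-nonneg (0≤δ (tgt j) (suc e)) (0≤ν j))
        0≤y : ∀ i j → 0ℚ ≤ y i j
        0≤y i j = +-nonneg (0≤z i j) (0≤x i j)
        row-y : ∀ i → sumFin (y i) ≡ μ i
        row-y i = begin
          sumFin (λ j → z i j + x i j)                               ≡⟨ ΣF.S-+ (z i) (x i) ⟩
          sumFin (z i) + sumFin (x i)                                ≡⟨ cong₂ _+_ (ΣF.S-* (ρ * (at src i * μ i)) (λ j → at tgt j * ν j)) (row i) ⟩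
          (ρ * (at src i * μ i)) * N + (μ i - (at src i * μ i) * (ρ * N)) ≡⟨ lem ρ (at src i * μ i) N (μ i) ⟩
          μ i ∎
          where
          open ≡-Reasoning
          lem : ∀ ρ a N k → (ρ * a) * N + (k - a * (ρ * N)) ≡ k
          lem = solve-∀ ℚ-ring
        column-y : ∀ j → sumFin (λ i → y i j) ≡ ν j
        column-y j = begin
          sumFin (λ i → z i j + x i j)                               ≡⟨ ΣF.S-+ (λ i → z i j) (λ i → x i j) ⟩
          sumFin (λ i → z i j) + sumFin (λ i → x i j)                ≡⟨ cong₂ _+_ (trans (ΣF.S-*ʳ (λ i → ρ * (at src i * μ i)) (at tgt j * ν j)) (cong (_* (at tgt j * ν j)) (ΣF.S-* ρ (λ i → at src i * μ i)))) (column j) ⟩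
          (ρ * M) * (at tgt j * ν j) + (ν j - (at tgt j * ν j) * (ρ * M)) ≡⟨ lem (ρ * M) (at tgt j * ν j) (ν j) ⟩
          ν j ∎
          where
          open ≡-Reasoning
          lem : ∀ c a k → c * a + (k - a * c) ≡ k
          lem = solve-∀ ℚ-ring
        -- `z i j` carries the factors `at src i` and `at tgt j`. Through `δ-cong` they replace both
        -- positions by `suc e`, and then `d-self` applies.
        dz≤0 : ∀ i j → d (src i) (tgt j) * z i j ≤ 0ℚ
        dz≤0 i j = ≤-trans (≤-reflexive (trans (lem (d (src i) (tgt j)) ρ (at src i) (μ i) (at tgt j) (ν j))
            (trans (cong (λ w → ρ * (μ i * ν j) * (at tgt j * w)) (δ-cong {i = src i} (λ u → d u (tgt j))))
              (trans (lem′ ρ (μ i) (ν j) (at tgt j) (at src i) (d (suc e) (tgt j)))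
                (cong (λ w → ρ * (μ i * ν j) * (at src i * w)) (δ-cong {i = tgt j} (λ v → d (suc e) v)))))))
          (≤-trans (≤-reflexive (lem″ (ρ * (μ i * ν j)) (at src i) (at tgt j) (d (suc e) (suc e))))
            (≤-trans (*-mono-nonneg (*-nonneg (*-nonneg 0≤ρ (*-nonneg (0≤μ i) (0≤ν j))) (*-nonneg (0≤δ (src i) (suc e)) (0≤δ (tgt j) (suc e)))) (d-self (suc e)))
              (≤-reflexive (*-zeroʳ ((ρ * (μ i * ν j)) * (at src i * at tgt j))))))
          where
          lem : ∀ d ρ s a t b → d * ((ρ * (s * a)) * (t * b)) ≡ ρ * (a * b) * (t * (s * d))
          lem = solve-∀ ℚ-ring
          lem′ : ∀ ρ a b t s d → ρ * (a * b) * (t * (s * d)) ≡ ρ * (a * b) * (s * (t * d))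
          lem′ = solve-∀ ℚ-ring
          lem″ : ∀ p s t d → p * (s * (t * d)) ≡ (p * (s * t)) * d
          lem″ = solve-∀ ℚ-ring
        dy≤ : ∀ i j → d (src i) (tgt j) * y i j ≤ (len e * at src i) * x i j + ((len e * at tgt j) * x i j + d (toPar e (src i)) (toPar e (tgt j)) * x i j)
        dy≤ i j = begin
          d (src i) (tgt j) * (z i j + x i j)                           ≡⟨ *-distribˡ-+ (d (src i) (tgt j)) (z i j) (x i j) ⟩
          d (src i) (tgt j) * z i j + d (src i) (tgt j) * x i j         ≤⟨ +-mono-≤ (dz≤0 i j) (*-monoʳ-≤-nonNeg (x i j) {{nonNegative (0≤x i j)}} d≤) ⟩
          0ℚ + (len e * at src i + (len e * at tgt j + d′)) * x i j     ≡⟨ lem (len e * at src i) (len e * at tgt j) d′ (x i j) ⟩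
          (len e * at src i) * x i j + ((len e * at tgt j) * x i j + d′ * x i j) ∎
          where
          open ≤-Reasoning
          d′ = d (toPar e (src i)) (toPar e (tgt j))
          d≤ : d (src i) (tgt j) ≤ len e * at src i + (len e * at tgt j + d′)
          d≤ = ≤-trans (d-toParˡ e (src i) (tgt j)) (+-monoʳ-≤ (len e * at src i) (d-toParʳ e (toPar e (src i)) (tgt j)))
          lem : ∀ a b c x → 0ℚ + (a + (b + c)) * x ≡ a * x + (b * x + c * x)
          lem = solve-∀ ℚ-ring
        cost-y : cost src tgt y ≤ treeCost (λ e′ → mass μ src e′ - mass ν tgt e′)
        cost-y = begin
          cost src tgt y
            ≤⟨ ΣF.S-mono (λ i → ΣF.S-mono (dy≤ i)) ⟩
          sumFin (λ i → sumFin (λ j → (len e * at src i) * x i j + ((len e * at tgt j) * x i j + d (toPar e (src i)) (toPar e (tgt j)) * x i j)))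
            ≡⟨ double-+ (λ i j → (len e * at src i) * x i j) (λ i j → (len e * at tgt j) * x i j + d (toPar e (src i)) (toPar e (tgt j)) * x i j) ⟩
          sumFin (λ i → sumFin (λ j → (len e * at src i) * x i j)) + sumFin (λ i → sumFin (λ j → (len e * at tgt j) * x i j + d (toPar e (src i)) (toPar e (tgt j)) * x i j))
            ≡⟨ cong₂ _+_ left (trans (double-+ (λ i j → (len e * at tgt j) * x i j) (λ i j → d (toPar e (src i)) (toPar e (tgt j)) * x i j)) (cong (_+ cost (toPar e ∘ src) (toPar e ∘ tgt) x) right)) ⟩
          len e * (M * (1ℚ - ρ * N)) + (len e * (N * (1ℚ - ρ * M)) + cost (toPar e ∘ src) (toPar e ∘ tgt) x)
            ≤⟨ +-monoʳ-≤ (len e * (M * (1ℚ - ρ * N))) (+-monoʳ-≤ (len e * (N * (1ℚ - ρ * M))) cost-x) ⟩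
          len e * (M * (1ℚ - ρ * N)) + (len e * (N * (1ℚ - ρ * M)) + treeCost F′)
            ≡⟨ trans (lem (len e) (M * (1ℚ - ρ * N)) (N * (1ℚ - ρ * M)) (treeCost F′)) (cong (λ w → len e * w + treeCost F′) gap) ⟩
          len e * abs (M - N) + treeCost F′
            ≡⟨ cong (_+ treeCost F′) (sym (sum-δ (λ e′ → len e′ * abs (M - N)) e)) ⟩
          sumFin (λ e′ → len e′ * abs (M - N) * δ e e′) + treeCost F′
            ≡⟨ ΣF.S-+ (λ e′ → len e′ * abs (M - N) * δ e e′) (λ e′ → len e′ * abs (F′ e′)) ⟨
          sumFin (λ e′ → len e′ * abs (M - N) * δ e e′ + len e′ * abs (F′ e′))
            ≡⟨ ΣF.S-cong (λ e′ → sym (edge e′)) ⟩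
          treeCost (λ e′ → mass μ src e′ - mass ν tgt e′) ∎
          where
          open ≤-Reasoning
          F′ : Fin m → ℚ
          F′ e′ = mass μ′ (toPar e ∘ src) e′ - mass ν′ (toPar e ∘ tgt) e′
          lem : ∀ l a b c → l * a + (l * b + c) ≡ l * (a + b) + c
          lem = solve-∀ ℚ-ring
          double-+ : ∀ (f g : Fin n → Fin n → ℚ) → sumFin (λ i → sumFin (λ j → f i j + g i j)) ≡ sumFin (λ i → sumFin (f i)) + sumFin (λ i → sumFin (g i))
          double-+ f g = trans (ΣF.S-cong (λ i → ΣF.S-+ (f i) (g i))) (ΣF.S-+ (λ i → sumFin (f i)) (λ i → sumFin (g i)))
          left : sumFin (λ i → sumFin (λ j → (len e * at src i) * x i j)) ≡ len e * (M * (1ℚ - ρ * N))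
          left = trans (ΣF.S-cong (λ i → trans (ΣF.S-* (len e * at src i) (x i)) (trans (cong ((len e * at src i) *_) (row i)) (*-assoc (len e) (at src i) (μ′ i)))))
            (trans (ΣF.S-* (len e) (λ i → at src i * μ′ i)) (cong (len e *_) (at-rest μ src (ρ * N))))
          right : sumFin (λ i → sumFin (λ j → (len e * at tgt j) * x i j)) ≡ len e * (N * (1ℚ - ρ * M))
          right = trans (ΣF.S-comm-Fin (λ i j → (len e * at tgt j) * x i j))
            (trans (ΣF.S-cong (λ j → trans (ΣF.S-* (len e * at tgt j) (λ i → x i j)) (trans (cong ((len e * at tgt j) *_) (column j)) (*-assoc (len e) (at tgt j) (ν′ j)))))
            (trans (ΣF.S-* (len e) (λ j → at tgt j * ν′ j)) (cong (len e *_) (at-rest ν tgt (ρ * M)))))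
          F≡ : ∀ e′ → mass μ src e′ - mass ν tgt e′ ≡ δ e e′ * (M - N) + F′ e′
          F≡ e′ = trans (cong₂ _-_ (mass-split μ src (ρ * N) e′) (mass-split ν tgt (ρ * M) e′))
            (lem₁ (δ e e′) M N (mass μ′ (toPar e ∘ src) e′) (mass ν′ (toPar e ∘ tgt) e′) ρ (χ e′ (par e)))
            where
            lem₁ : ∀ a M N f g ρ c → (a * M + (f + (M * (ρ * N)) * c)) - (a * N + (g + (N * (ρ * M)) * c)) ≡ a * (M - N) + (f - g)
            lem₁ = solve-∀ ℚ-ring
          edge : ∀ e′ → len e′ * abs (mass μ src e′ - mass ν tgt e′) ≡ len e′ * abs (M - N) * δ e e′ + len e′ * abs (F′ e′)
          edge e′ = weighted-abs-split e e′ (len e′) (M - N) (F≡ e′) pushed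
            where
            -- After the push all positions have index at most `toℕ e`, hence none lies below `e`.
            -- All imbalance on `e` is the M - N just paid for.
            pushed : e ≡ e′ → F′ e′ ≡ 0ℚ
            pushed refl = cong₂ _-_ (mass-pushed μ′ src src≤) (mass-pushed ν′ tgt tgt≤)

    push-up : ∀ e → Claim (toℕ e) → Claim (suc (toℕ e))
    push-up e claim μ ν src tgt 0≤μ 0≤ν Σμ≡Σν src≤ tgt≤ =
      let open PushUp e μ ν src tgt 0≤μ 0≤ν src≤ tgt≤
          (ρ , 0≤ρ , 0≤1-ρN , 0≤1-ρM , gap) = cancelRatio (0≤here-mass μ src 0≤μ) (0≤here-mass ν tgt 0≤ν)
          (x , plan , cost-x) = claim (rest μ src (ρ * N)) (rest ν tgt (ρ * M)) (toPar e ∘ src) (toPar e ∘ tgt)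
            (0≤rest μ src (ρ * N) 0≤μ 0≤1-ρN) (0≤rest ν tgt (ρ * M) 0≤ν 0≤1-ρM)
            (trans (sum-rest μ src (ρ * N)) (trans (cong₂ _-_ Σμ≡Σν (lem M N ρ)) (sym (sum-rest ν tgt (ρ * M)))))
            (λ i → toPar-≤ e (src i) (src≤ i)) (λ j → toPar-≤ e (tgt j) (tgt≤ j))
      in extend ρ 0≤ρ gap x plan cost-x
      where
      lem : ∀ M N ρ → M * (ρ * N) ≡ N * (ρ * M)
      lem = solve-∀ ℚ-ring

    claim : ∀ b → b ℕ.≤ m → Claim b
    claim zero    _   = at-root
    -- The edge with index b joins the leaf with index b + 1 to its parent; the transports along
    -- `toℕ-fromℕ<` only fix the index.
    claim (suc b) b<m = subst (Claim ∘ suc) (toℕ-fromℕ< b<m)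
      (push-up (fromℕ< b<m) (subst Claim (sym (toℕ-fromℕ< b<m)) (claim b (ℕ.<⇒≤ b<m))))

  transport : ∀ μ ν (src tgt : Fin n → Fin (suc m)) →
    (∀ i → 0ℚ ≤ μ i) → (∀ j → 0ℚ ≤ ν j) → sumFin μ ≡ sumFin ν →
    Σ (Fin n → Fin n → ℚ) λ x → IsPlan μ ν x × (cost src tgt x ≤ treeCost (λ e → mass μ src e - mass ν tgt e))
  transport μ ν src tgt 0≤μ 0≤ν Σμ≡Σν =
    claim m ℕ.≤-refl μ ν src tgt 0≤μ 0≤ν Σμ≡Σν (λ i → ℕ.≤-pred (toℕ<n (src i))) (λ j → ℕ.≤-pred (toℕ<n (tgt j)))

-- An upper bound for the optimum of the LP

hits : ∀ {n} → (Fin n → ℚ) → Subset n → ℚ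
hits c T = sumFin (λ i → 𝟙 T i * c i)

module _ {m : ℕ} (t : Tree m) (d : Fin (suc m) → Fin (suc m) → ℚ) (metric : IsShortestPathMetric t d)
  {n : ℕ} .{{nz : ℕ.NonZero n}} (loc : Fin n → Fin (suc m)) where
  open TreeMetric t d metric
  open Transport t d metric
  open Matching (λ i j → d (loc i) (loc j))

  -- A plan with these margins is feasible: its rows outside `T` are nonnegative with sum zero,
  -- hence zero, so restricting column sums and objective to `T` loses nothing.
  objective≤cost : ∀ {k} T → ∣ T ∣ ≡ suc k → ∀ x y → Optimal T x →
    IsPlan (λ i → 𝟙 T i * (pos 1 / suc k)) (λ _ → pos 1 / n) y → objective T x ≤ cost loc loc y
  objective≤cost {k} T ∣T∣≡ x y (_ , optimal) (0≤y , row , column) = begin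
    objective T x
      ≤⟨ optimal y (rows , columns , λ i j _ → 0≤y i j) ⟩
    objective T y
      ≡⟨ trans (sumIn≡ T (λ i → sumFin (λ j → d (loc i) (loc j) * y i j))) (ΣF.S-cong (λ i →
           trans (sym (ΣF.S-* (𝟙 T i) (λ j → d (loc i) (loc j) * y i j)))
             (ΣF.S-cong (λ j → trans (lem (𝟙 T i) (d (loc i) (loc j)) (y i j)) (cong (d (loc i) (loc j) *_) (supported i j)))))) ⟩
    cost loc loc y ∎
    where
    open ≤-Reasoning
    lem : ∀ i d y → i * (d * y) ≡ d * (i * y)
    lem = solve-∀ ℚ-ring
    supported : ∀ i j → 𝟙 T i * y i j ≡ y i j
    supported i j with i ∈? T
    ... | yes i∈T = 𝟙*-∈ (y i j) i∈T
    ... | no  i∉T = trans (𝟙*-∉ (y i j) i∉T) (≤-antisym (0≤y i j)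
      (≤-trans (term≤sum (y i) (0≤y i) j) (≤-reflexive (trans (row i) (𝟙*-∉ (pos 1 / suc k) i∉T)))))
    rows : ∀ i → i ∈ T → ℕtoℚ ∣ T ∣ * sumFin (y i) ≡ 1ℚ
    rows i i∈T = trans (cong₂ _*_ (cong ℕtoℚ ∣T∣≡) (trans (row i) (𝟙*-∈ (pos 1 / suc k) i∈T))) (n*[1/n]≡1 (suc k))
    columns : ∀ j → ℕtoℚ n * sumIn T (λ i → y i j) ≡ 1ℚ
    columns j = trans (cong (ℕtoℚ n *_) (trans (sumIn≡ T (λ i → y i j)) (trans (ΣF.S-cong (λ i → supported i j)) (column j)))) (n*[1/n]≡1 n)

  objective≤treeCost : ∀ {k} T → ∣ T ∣ ≡ suc k → ∀ x → Optimal T x →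
    objective T x ≤ treeCost (λ e → hits (χ e ∘ loc) T * (pos 1 / suc k) - sumFin (χ e ∘ loc) * (pos 1 / n))
  objective≤treeCost {k} T ∣T∣≡ x optimal =
    let (y , plan , cost-y) = transport (λ i → 𝟙 T i * (pos 1 / suc k)) (λ _ → pos 1 / n) loc loc
          (λ i → *-nonneg (0≤𝟙 T i) (0≤1/n (suc k))) (λ _ → 0≤1/n n)
          (trans total (sym (trans (sumFin-const n (pos 1 / n)) (n*[1/n]≡1 n))))
    in ≤-trans (objective≤cost T ∣T∣≡ x y optimal plan) (≤-trans cost-y (≤-reflexive
      (ΣF.S-cong (λ e → cong (λ f → Tree.len t e * abs f) (cong₂ _-_
           (trans (ΣF.S-cong (λ i → lem (𝟙 T i) (pos 1 / suc k) (χ e (loc i)))) (ΣF.S-*ʳ (λ i → 𝟙 T i * χ e (loc i)) (pos 1 / suc k)))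
           (trans (ΣF.S-* (pos 1 / n) (χ e ∘ loc)) (*-comm (pos 1 / n) (sumFin (χ e ∘ loc)))))))))
    where
    lem : ∀ i u c → (i * u) * c ≡ (i * c) * u
    lem = solve-∀ ℚ-ring
    total : sumFin (λ i → 𝟙 T i * (pos 1 / suc k)) ≡ 1ℚ
    total = trans (ΣF.S-*ʳ (𝟙 T) (pos 1 / suc k)) (trans (cong (_* (pos 1 / suc k)) (trans (sum-𝟙 T) (cong ℕtoℚ ∣T∣≡))) (n*[1/n]≡1 (suc k)))

-- The potential of one edge

1/suc : ℕ → ℚ
1/suc k = pos 1 / suc k

[1+k]/[1+k] : ∀ k → (1ℚ + ℕtoℚ k) * 1/suc k ≡ 1ℚ
[1+k]/[1+k] k = trans (cong (_* 1/suc k) (sym (ℕtoℚ-suc k))) (n*[1/n]≡1 (suc k))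

-- β k = C(2k,k) / 4ᵏ, a rational stand-in for 1/√(πk) whose partial sums, and those of 1/(k β k), telescope.
β : ℕ → ℚ
β zero    = 1ℚ
β (suc k) = β k * (1ℚ - ½ * 1/suc k)

private
  1-1/suc : ∀ k → 1ℚ - 1/suc k ≡ ℕtoℚ k * 1/suc k
  1-1/suc k = trans (cong (_- 1/suc k) (sym ([1+k]/[1+k] k))) (lem (ℕtoℚ k) (1/suc k))
    where
    lem : ∀ K u → (1ℚ + K) * u - u ≡ K * u
    lem = solve-∀ ℚ-ring

  0≤1-1/suc : ∀ k → 0ℚ ≤ 1ℚ - 1/suc k
  0≤1-1/suc k = subst (0ℚ ≤_) (sym (1-1/suc k)) (*-nonneg (0≤ℕtoℚ k) (0≤1/n (suc k)))

  0<1-½/suc : ∀ k → 0ℚ < 1ℚ - ½ * 1/suc k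
  0<1-½/suc k = subst (0ℚ <_) (sym (lem (1/suc k))) (+-mono-<-≤ (positive⁻¹ ½) (*-nonneg (nonNegative⁻¹ ½) (0≤1-1/suc k)))
    where
    lem : ∀ u → 1ℚ - ½ * u ≡ ½ + ½ * (1ℚ - u)
    lem = solve-∀ ℚ-ring

0<β : ∀ k → 0ℚ < β k
0<β zero    = positive⁻¹ 1ℚ
0<β (suc k) = *-pos (0<β k) (0<1-½/suc k)

β≤1 : ∀ k → β k ≤ 1ℚ
β≤1 zero    = ≤-refl
β≤1 (suc k) = ≤-trans (≤-by-gap (β k * (½ * 1/suc k)) (*-nonneg (<⇒≤ (0<β k)) (*-nonneg (nonNegative⁻¹ ½) (0≤1/n (suc k)))) (lem (β k) (½ * 1/suc k))) (β≤1 k)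
  where
  lem : ∀ b w → b ≡ b * (1ℚ - w) + b * w
  lem = solve-∀ ℚ-ring

γ : ℕ → ℚ
γ k = proj₁ (inverse (0<β k))

0≤γ : ∀ k → 0ℚ ≤ γ k
0≤γ k = proj₁ (proj₂ (inverse (0<β k)))

γβ≡1 : ∀ k → γ k * β k ≡ 1ℚ
γβ≡1 k = proj₂ (proj₂ (inverse (0<β k)))

γ-suc : ∀ k → γ (suc k) ≡ γ k + γ (suc k) * (½ * 1/suc k)
γ-suc k = begin
  γ′                                        ≡⟨ lem₁ γ′ w ⟩
  1ℚ * (γ′ * (1ℚ - w)) + γ′ * w             ≡⟨ cong (λ x → x * (γ′ * (1ℚ - w)) + γ′ * w) (γβ≡1 k) ⟨
  (γ k * β k) * (γ′ * (1ℚ - w)) + γ′ * w    ≡⟨ lem₂ (γ k) (β k) γ′ w ⟩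
  γ k * (γ′ * (β k * (1ℚ - w))) + γ′ * w    ≡⟨ cong (λ x → γ k * x + γ′ * w) (γβ≡1 (suc k)) ⟩
  γ k * 1ℚ + γ′ * w                         ≡⟨ cong (_+ γ′ * w) (*-identityʳ (γ k)) ⟩
  γ k + γ′ * w                              ∎
  where
  open ≡-Reasoning
  γ′ = γ (suc k)
  w = ½ * 1/suc k
  lem₁ : ∀ g w → g ≡ 1ℚ * (g * (1ℚ - w)) + g * w
  lem₁ = solve-∀ ℚ-ring
  lem₂ : ∀ g b g′ w → (g * b) * (g′ * (1ℚ - w)) + g′ * w ≡ g * (g′ * (b * (1ℚ - w))) + g′ * w
  lem₂ = solve-∀ ℚ-ring

-- The ratio 2 (k + 1) β (k + 1) = (2 k + 1) β k of central binomial coefficients, in telescoping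
-- form: (2 k + 1) β k - 1 is β 1 + ... + β k.
β-suc : ∀ k → (1ℚ + ((1ℚ + ℕtoℚ k) + (1ℚ + ℕtoℚ k))) * β (suc k) ≡ (1ℚ + (ℕtoℚ k + ℕtoℚ k)) * β k + β (suc k)
β-suc k = begin
  (1ℚ + ((1ℚ + K) + (1ℚ + K))) * (β k * (1ℚ - ½ * u))                    ≡⟨ lem₁ K (β k) u ⟩
  ((1ℚ + K) + (1ℚ + K) - (1ℚ + K) * u) * β k + β k * (1ℚ - ½ * u)        ≡⟨ cong (λ x → ((1ℚ + K) + (1ℚ + K) - x) * β k + β k * (1ℚ - ½ * u)) ([1+k]/[1+k] k) ⟩
  ((1ℚ + K) + (1ℚ + K) - 1ℚ) * β k + β k * (1ℚ - ½ * u)                  ≡⟨ lem₂ K (β k) (β k * (1ℚ - ½ * u)) ⟩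
  (1ℚ + (K + K)) * β k + β k * (1ℚ - ½ * u)                              ∎
  where
  open ≡-Reasoning
  K = ℕtoℚ k
  u = 1/suc k
  lem₁ : ∀ K b u → (1ℚ + ((1ℚ + K) + (1ℚ + K))) * (b * (1ℚ - ½ * u)) ≡ ((1ℚ + K) + (1ℚ + K) - (1ℚ + K) * u) * b + b * (1ℚ - ½ * u)
  lem₁ = solve-∀ ℚ-ring
  lem₂ : ∀ K b w → ((1ℚ + K) + (1ℚ + K) - 1ℚ) * b + w ≡ (1ℚ + (K + K)) * b + w
  lem₂ = solve-∀ ℚ-ring

am-gm : ∀ A B y → 0ℚ ≤ B → A * B ≡ 1ℚ → abs y ≤ ½ * A * (y * y) + ½ * B
am-gm A B y 0≤B AB≡1 = ≤-by-gap (½ * B * ((A * abs y - 1ℚ) * (A * abs y - 1ℚ)))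
  (*-nonneg (*-nonneg (nonNegative⁻¹ ½) 0≤B) (square-nonneg (A * abs y - 1ℚ))) (begin
    ½ * A * (y * y) + ½ * B
      ≡⟨ cong (λ z → ½ * A * z + ½ * B) (abs-square y) ⟨
    ½ * A * (abs y * abs y) + ½ * B
      ≡⟨ lem₁ A B (abs y) ⟩
    1ℚ * abs y + (½ * A * 1ℚ * (abs y * abs y) - 1ℚ * abs y + ½ * B)
      ≡⟨ cong (λ z → 1ℚ * abs y + (½ * A * z * (abs y * abs y) - z * abs y + ½ * B)) AB≡1 ⟨
    1ℚ * abs y + (½ * A * (A * B) * (abs y * abs y) - (A * B) * abs y + ½ * B)
      ≡⟨ lem₂ A B (abs y) ⟩
    abs y + ½ * B * ((A * abs y - 1ℚ) * (A * abs y - 1ℚ)) ∎)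
  where
  open ≡-Reasoning
  lem₁ : ∀ A B z → ½ * A * (z * z) + ½ * B ≡ 1ℚ * z + (½ * A * 1ℚ * (z * z) - 1ℚ * z + ½ * B)
  lem₁ = solve-∀ ℚ-ring
  lem₂ : ∀ A B z → 1ℚ * z + (½ * A * (A * B) * (z * z) - (A * B) * z + ½ * B) ≡ z + ½ * B * ((A * z - 1ℚ) * (A * z - 1ℚ))
  lem₂ = solve-∀ ℚ-ring

module Potential (p α τ : ℚ) (0≤α : 0ℚ ≤ α) (0≤τ : 0ℚ ≤ τ) (ατ≡1 : α * τ ≡ 1ℚ) where

  -- Removing a uniformly random one of k servers preserves L x in expectation and multiplies
  -- k (x - p)² - L x by 1 - 1/(k - 1); since the latter starts at - v ≤ 0, its coefficient N only helps.
  L : ℚ → ℚ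
  L x = p * p + (1ℚ - (p + p)) * x

  -- At size i, AM-GM bounds ∣ x - p ∣ by ½ α γ i (x - p)² + ½ τ β i. `P k` is the sum of ½ α γ i /
  -- i over 1 ≤ i ≤ k and `C k` that of ½ τ β i, both in closed form; `P` treats (x - p)² as if it
  -- were L x / i. `N` collects the coefficients of the error i (x - p)² - L x, damped at each
  -- removal.
  P C N : ℕ → ℚ
  P k = α * (γ k - 1ℚ)
  C k = ½ * τ * ((1ℚ + (ℕtoℚ k + ℕtoℚ k)) * β k - 1ℚ)
  N zero          = 0ℚ
  N (suc zero)    = ½ * (α * γ 1)
  N (suc (suc k)) = ½ * (α * γ (suc (suc k))) * 1/suc (suc k) + (1ℚ - 1/suc k) * N (suc k)

  0≤N : ∀ k → 0ℚ ≤ N k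
  0≤N zero          = ≤-refl
  0≤N (suc zero)    = *-nonneg (nonNegative⁻¹ ½) (*-nonneg 0≤α (0≤γ 1))
  0≤N (suc (suc k)) = +-nonneg (*-nonneg (*-nonneg (nonNegative⁻¹ ½) (*-nonneg 0≤α (0≤γ (suc (suc k))))) (0≤1/n (suc (suc k))))
                               (*-nonneg (0≤1-1/suc k) (0≤N (suc k)))

  Φ : ℕ → ℚ → ℚ
  Φ k x = L x * P k + C k + (ℕtoℚ k * ((x - p) * (x - p)) - L x) * N k

  private
    P-suc : ∀ k → P (suc k) ≡ P k + ½ * (α * γ (suc k)) * 1/suc k
    P-suc k = trans (cong (λ g → α * (g - 1ℚ)) (γ-suc k)) (lem α (γ k) (γ (suc k)) (1/suc k))
      where
      lem : ∀ a g g′ u → a * (g + g′ * (½ * u) - 1ℚ) ≡ a * (g - 1ℚ) + ½ * (a * g′) * u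
      lem = solve-∀ ℚ-ring

    C-suc : ∀ k → C (suc k) ≡ C k + ½ * (τ * β (suc k))
    C-suc k = trans (cong (λ K → ½ * τ * ((1ℚ + (K + K)) * β (suc k) - 1ℚ)) (ℕtoℚ-suc k))
      (trans (cong (λ w → ½ * τ * (w - 1ℚ)) (β-suc k)) (lem τ ((1ℚ + (ℕtoℚ k + ℕtoℚ k)) * β k) (β (suc k))))
      where
      lem : ∀ t w b → ½ * t * (w + b - 1ℚ) ≡ ½ * t * (w - 1ℚ) + ½ * (t * b)
      lem = solve-∀ ℚ-ring

    0≤τβ : ∀ k → 0ℚ ≤ τ * β k
    0≤τβ k = *-nonneg 0≤τ (<⇒≤ (0<β k))

    αγ*τβ≡1 : ∀ k → (α * γ k) * (τ * β k) ≡ 1ℚ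
    αγ*τβ≡1 k = trans (lem α (γ k) τ (β k)) (trans (cong₂ _*_ ατ≡1 (γβ≡1 k)) (*-identityˡ 1ℚ))
      where
      lem : ∀ a g t b → (a * g) * (t * b) ≡ (a * t) * (g * b)
      lem = solve-∀ ℚ-ring

  Φ-0 : ∀ x → Φ 0 x ≡ 0ℚ
  Φ-0 x = trans (cong (λ g → L x * (α * (g - 1ℚ)) + C 0 + (0ℚ * ((x - p) * (x - p)) - L x) * 0ℚ) (trans (sym (*-identityʳ (γ 0))) (γβ≡1 0)))
    (lem (L x) α τ ((x - p) * (x - p)))
    where
    lem : ∀ l a t y → l * (a * (1ℚ - 1ℚ)) + ½ * t * ((1ℚ + (0ℚ + 0ℚ)) * 1ℚ - 1ℚ) + (0ℚ * y - l) * 0ℚ ≡ 0ℚ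
    lem = solve-∀ ℚ-ring

  -- The base case is size one, since `Φ-step` divides by the number of servers left. `N 1` is
  -- chosen to make the L terms cancel, leaving exactly the AM-GM bound.
  Φ-1 : ∀ x → abs (x - p) ≤ Φ 1 x
  Φ-1 x = ≤-trans (am-gm (α * γ 1) (τ * β 1) (x - p) (0≤τβ 1) (αγ*τβ≡1 1)) (≤-reflexive (sym (begin
    L x * P 1 + C 1 + (1ℚ * ((x - p) * (x - p)) - L x) * (½ * (α * γ 1))
      ≡⟨ cong₂ (λ a b → L x * a + b + (1ℚ * ((x - p) * (x - p)) - L x) * (½ * (α * γ 1))) (P-suc 0) (C-suc 0) ⟩
    L x * (P 0 + ½ * (α * γ 1) * 1ℚ) + (C 0 + ½ * (τ * β 1)) + (1ℚ * ((x - p) * (x - p)) - L x) * (½ * (α * γ 1))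
      ≡⟨ lem (L x) (P 0) (C 0) (α * γ 1) (τ * β 1) ((x - p) * (x - p)) ⟩
    (L x * P 0 + C 0 + (0ℚ * ((x - p) * (x - p)) - L x) * 0ℚ) + (½ * (α * γ 1) * ((x - p) * (x - p)) + ½ * (τ * β 1))
      ≡⟨ trans (cong (_+ (½ * (α * γ 1) * ((x - p) * (x - p)) + ½ * (τ * β 1))) (Φ-0 x)) (+-identityˡ (½ * (α * γ 1) * ((x - p) * (x - p)) + ½ * (τ * β 1))) ⟩
    ½ * (α * γ 1) * ((x - p) * (x - p)) + ½ * (τ * β 1) ∎)))
    where
    open ≡-Reasoning
    lem : ∀ l P C a b y → l * (P + ½ * a * 1ℚ) + (C + ½ * b) + (1ℚ * y - l) * (½ * a) ≡ (l * P + C + (0ℚ * y - l) * 0ℚ) + (½ * a * y + ½ * b)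
    lem = solve-∀ ℚ-ring

  -- Of `suc k` servers a fraction `x` are hits. Removing a miss moves the fraction to x + x / k,
  -- removing a hit to x + (x - 1) / k, and a uniform removal takes a hit with probability x.
  Φ-step : ∀ j x → let k = suc j ; u = 1/suc j in
    abs (x - p) + ((1ℚ - x) * Φ k (x + x * u) + x * Φ k (x + (x - 1ℚ) * u)) ≤ Φ (suc k) x
  Φ-step j x = begin
    abs y + ((1ℚ - x) * Φ k (x + x * u) + x * Φ k (x + (x - 1ℚ) * u))
      ≤⟨ +-mono-≤ (am-gm A B y (0≤τβ (suc k)) (αγ*τβ≡1 (suc k))) (≤-reflexive averaged) ⟩
    (½ * A * (y * y) + ½ * B) + (L x * P k + C k + ((1ℚ + K) * (y * y) - L x) * ((1ℚ - u) * N k))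
      ≡⟨ lem₁ A B (y * y) (L x) (P k) (C k) (1ℚ + K) ((1ℚ - u) * N k) ⟩
    ½ * A * 1ℚ * (y * y) + (L x * P k + (C k + ½ * B) + ((1ℚ + K) * (y * y) - L x) * ((1ℚ - u) * N k))
      ≡⟨ cong (λ w → ½ * A * w * (y * y) + (L x * P k + (C k + ½ * B) + ((1ℚ + K) * (y * y) - L x) * ((1ℚ - u) * N k))) ([1+k]/[1+k] k) ⟨
    ½ * A * ((1ℚ + K) * 1/suc k) * (y * y) + (L x * P k + (C k + ½ * B) + ((1ℚ + K) * (y * y) - L x) * ((1ℚ - u) * N k))
      ≡⟨ lem₂ A (1ℚ + K) (1/suc k) (y * y) (L x) (P k) (C k + ½ * B) ((1ℚ - u) * N k) ⟩
    L x * (P k + ½ * A * 1/suc k) + (C k + ½ * B) + ((1ℚ + K) * (y * y) - L x) * (½ * A * 1/suc k + (1ℚ - u) * N k)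
      ≡⟨ cong₂ (λ a b → L x * a + b + ((1ℚ + K) * (y * y) - L x) * N (suc k)) (P-suc k) (C-suc k) ⟨
    L x * P (suc k) + C (suc k) + ((1ℚ + K) * (y * y) - L x) * N (suc k)
      ≡⟨ cong (λ J → L x * P (suc k) + C (suc k) + (J * (y * y) - L x) * N (suc k)) (ℕtoℚ-suc k) ⟨
    Φ (suc k) x ∎
    where
    open ≤-Reasoning
    k = suc j
    u = 1/suc j
    K = ℕtoℚ k
    y = x - p
    A = α * γ (suc k)
    B = τ * β (suc k)
    lem₁ : ∀ A B y l P C K n → (½ * A * y + ½ * B) + (l * P + C + (K * y - l) * n) ≡ ½ * A * 1ℚ * y + (l * P + (C + ½ * B) + (K * y - l) * n)
    lem₁ = solve-∀ ℚ-ring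
    lem₂ : ∀ A K w y l P C n → ½ * A * (K * w) * y + (l * P + C + (K * y - l) * n) ≡ l * (P + ½ * A * w) + C + (K * y - l) * (½ * A * w + n)
    lem₂ = solve-∀ ℚ-ring
    Ku≡1 : K * u ≡ 1ℚ
    Ku≡1 = n*[1/n]≡1 (suc j)
    expand : ∀ x p u K P C n →
      (1ℚ - x) * ((p * p + (1ℚ - (p + p)) * (x + x * u)) * P + C + (K * ((x + x * u - p) * (x + x * u - p)) - (p * p + (1ℚ - (p + p)) * (x + x * u))) * n)
      + x * ((p * p + (1ℚ - (p + p)) * (x + (x - 1ℚ) * u)) * P + C + (K * ((x + (x - 1ℚ) * u - p) * (x + (x - 1ℚ) * u - p)) - (p * p + (1ℚ - (p + p)) * (x + (x - 1ℚ) * u))) * n)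
      ≡ (p * p + (1ℚ - (p + p)) * x) * P + C + ((K * ((x - p) * (x - p)) + (K * u) * u * (x * (1ℚ - x))) - (p * p + (1ℚ - (p + p)) * x)) * n
    expand = solve-∀ ℚ-ring
    collect : ∀ x p u K → (K * ((x - p) * (x - p)) + 1ℚ * u * (x * (1ℚ - x))) - (p * p + (1ℚ - (p + p)) * x)
      ≡ (K + 1ℚ - 1ℚ - u) * ((x - p) * (x - p)) - (1ℚ - u) * (p * p + (1ℚ - (p + p)) * x)
    collect = solve-∀ ℚ-ring
    factor : ∀ u K y l n → ((K + 1ℚ - K * u - u) * y - (1ℚ - u) * l) * n ≡ ((1ℚ + K) * y - l) * ((1ℚ - u) * n)
    factor = solve-∀ ℚ-ring
    averaged : (1ℚ - x) * Φ k (x + x * u) + x * Φ k (x + (x - 1ℚ) * u) ≡ L x * P k + C k + ((1ℚ + K) * (y * y) - L x) * ((1ℚ - u) * N k)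
    averaged = begin-equality
      (1ℚ - x) * Φ k (x + x * u) + x * Φ k (x + (x - 1ℚ) * u)
        ≡⟨ expand x p u K (P k) (C k) (N k) ⟩
      L x * P k + C k + ((K * (y * y) + (K * u) * u * (x * (1ℚ - x))) - L x) * N k
        ≡⟨ cong (λ w → L x * P k + C k + ((K * (y * y) + w * u * (x * (1ℚ - x))) - L x) * N k) Ku≡1 ⟩
      L x * P k + C k + ((K * (y * y) + 1ℚ * u * (x * (1ℚ - x))) - L x) * N k
        -- The variance created by the removal is x (1 - x) = L x - (x - p)². Writing one 1 back as
        -- `K * u` then lets the coefficient of (x - p)² factor as (1 + K) (1 - u).
        ≡⟨ cong (λ w → L x * P k + C k + w * N k) (trans (collect x p u K) (cong (λ w → (K + 1ℚ - w - u) * (y * y) - (1ℚ - u) * L x) (sym Ku≡1))) ⟩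
      L x * P k + C k + ((K + 1ℚ - K * u - u) * (y * y) - (1ℚ - u) * L x) * N k
        ≡⟨ cong (L x * P k + C k +_) (factor u K (y * y) (L x) (N k)) ⟩
      L x * P k + C k + ((1ℚ + K) * (y * y) - L x) * ((1ℚ - u) * N k) ∎

  Φ-final : ∀ k → 0ℚ ≤ p * (1ℚ - p) → Φ k p ≤ (p * (1ℚ - p)) * (α * γ k) + τ * (ℕtoℚ k * β k)
  Φ-final k 0≤v = ≤-by-gap (v * α + ½ * τ * (1ℚ - β k) + v * N k)
    (+-nonneg (+-nonneg (*-nonneg 0≤v 0≤α) (*-nonneg (*-nonneg (nonNegative⁻¹ ½) 0≤τ) (p≤q⇒0≤q-p (β≤1 k)))) (*-nonneg 0≤v (0≤N k)))
    (lem p α (γ k) τ (ℕtoℚ k) (β k) (N k))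
    where
    v = p * (1ℚ - p)
    lem : ∀ p α g τ K b n → (p * (1ℚ - p)) * (α * g) + τ * (K * b) ≡
      ((p * p + (1ℚ - (p + p)) * p) * (α * (g - 1ℚ)) + ½ * τ * ((1ℚ + (K + K)) * b - 1ℚ) + (K * ((p - p) * (p - p)) - (p * p + (1ℚ - (p + p)) * p)) * n)
      + ((p * (1ℚ - p)) * α + ½ * τ * (1ℚ - b) + (p * (1ℚ - p)) * n)
    lem = solve-∀ ℚ-ring

-- Removing random servers from a 0/1-labelled set

Is01 : ∀ {n} → (Fin n → ℚ) → Set
Is01 c = ∀ i → c i ≡ 0ℚ ⊎ c i ≡ 1ℚ

-- On two points every function is affine. Hence a sum of `g` over labelled servers depends on the
-- labels only through the number of hits.
mix-01 : ∀ (g : ℚ → ℚ) {x} → x ≡ 0ℚ ⊎ x ≡ 1ℚ → g x ≡ (1ℚ - x) * g 0ℚ + x * g 1ℚ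
mix-01 g (inj₁ refl) = lem (g 0ℚ) (g 1ℚ)
  where
  lem : ∀ a b → a ≡ (1ℚ - 0ℚ) * a + 0ℚ * b
  lem = solve-∀ ℚ-ring
mix-01 g (inj₂ refl) = lem (g 0ℚ) (g 1ℚ)
  where
  lem : ∀ a b → b ≡ (1ℚ - 1ℚ) * a + 1ℚ * b
  lem = solve-∀ ℚ-ring

-- The only trace of integrality that is used: it bounds `v` away from zero on edges with servers on
-- both sides.
sum-01 : ∀ {n} (c : Fin n → ℚ) → Is01 c → sumFin c ≡ 0ℚ ⊎ 1ℚ ≤ sumFin c
sum-01 {zero}  c c01 = inj₁ refl
sum-01 {suc n} c c01 with c01 zero | sum-01 (c ∘ suc) (c01 ∘ suc)
... | inj₁ c₀≡0 | inj₁ Σ≡0 = inj₁ (cong₂ _+_ c₀≡0 Σ≡0)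
... | inj₁ c₀≡0 | inj₂ 1≤Σ = inj₂ (subst (1ℚ ≤_) (sym (trans (cong (_+ sumFin (c ∘ suc)) c₀≡0) (+-identityˡ (sumFin (c ∘ suc))))) 1≤Σ)
... | inj₂ c₀≡1 | inj₁ Σ≡0 = inj₂ (≤-reflexive (sym (cong₂ _+_ c₀≡1 Σ≡0)))
... | inj₂ c₀≡1 | inj₂ 1≤Σ = inj₂ (subst (λ x → 1ℚ ≤ x + sumFin (c ∘ suc)) (sym c₀≡1)
  (≤-by-gap (sumFin (c ∘ suc)) (≤-trans (nonNegative⁻¹ 1ℚ) 1≤Σ) refl))

0≤01 : ∀ {x} → x ≡ 0ℚ ⊎ x ≡ 1ℚ → 0ℚ ≤ x
0≤01 (inj₁ refl) = ≤-refl
0≤01 (inj₂ refl) = nonNegative⁻¹ 1ℚ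

1-01 : ∀ {x} → x ≡ 0ℚ ⊎ x ≡ 1ℚ → 1ℚ - x ≡ 0ℚ ⊎ 1ℚ - x ≡ 1ℚ
1-01 (inj₁ refl) = inj₂ refl
1-01 (inj₂ refl) = inj₁ refl

module Sampling {n′ : ℕ} (c : Fin (suc n′) → ℚ) (c01 : Is01 c) where
  n = suc n′

  p v : ℚ
  p = sumFin c * 1/suc n′
  v = p * (1ℚ - p)

  n*p≡sum : ℕtoℚ n * p ≡ sumFin c
  n*p≡sum = trans (lem (ℕtoℚ n) (sumFin c) (1/suc n′)) (trans (cong (sumFin c *_) (n*[1/n]≡1 n)) (*-identityʳ (sumFin c)))
    where
    lem : ∀ a b c → a * (b * c) ≡ b * (a * c)
    lem = solve-∀ ℚ-ring

  sum-1-c : sumFin (λ i → 1ℚ - c i) ≡ ℕtoℚ n - sumFin c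
  sum-1-c = trans (ΣF.S-- (λ _ → 1ℚ) c) (cong (_- sumFin c) (trans (sumFin-const n 1ℚ) (*-identityʳ (ℕtoℚ n))))

  n*[1-p]≡sum : ℕtoℚ n * (1ℚ - p) ≡ sumFin (λ i → 1ℚ - c i)
  n*[1-p]≡sum = trans (lem (ℕtoℚ n) p) (trans (cong (λ x → ℕtoℚ n - x) n*p≡sum) (sym sum-1-c))
    where
    lem : ∀ a p → a * (1ℚ - p) ≡ a - a * p
    lem = solve-∀ ℚ-ring

  0≤p : 0ℚ ≤ p
  0≤p = *-nonneg (ΣF.S-nonneg (λ i → 0≤01 (c01 i))) (0≤1/n n)

  0≤1-p : 0ℚ ≤ 1ℚ - p
  0≤1-p = *-cancel-pos (0<ℕtoℚ n′) (subst (_≤ ℕtoℚ n * (1ℚ - p)) (sym (*-zeroʳ (ℕtoℚ n)))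
    (subst (0ℚ ≤_) (sym n*[1-p]≡sum) (ΣF.S-nonneg (λ i → 0≤01 (1-01 (c01 i))))))

  0≤v : 0ℚ ≤ v
  0≤v = *-nonneg 0≤p 0≤1-p

  -- The expected sum, over k steps each removing a uniformly random element of T, of ∣ hits / size - p ∣.
  deviation : ℕ → Subset n → ℚ
  deviation zero    T = 0ℚ
  deviation (suc k) T = abs (hits c T * 1/suc k - p) + 1/suc k * sumFin (λ s → 𝟙 T s * deviation k (T ∖ s))

  module _ (α τ : ℚ) (0≤α : 0ℚ ≤ α) (0≤τ : 0ℚ ≤ τ) (ατ≡1 : α * τ ≡ 1ℚ) where
    open Potential p α τ 0≤α 0≤τ ατ≡1

    -- The bound for the remaining set depends only on the label of the removed server, so averaging
    -- over `T` collapses by `mix-01` to the two branches of `Φ-step`.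
    deviation≤Φ : ∀ k T → ∣ T ∣ ≡ suc k → deviation (suc k) T ≤ Φ (suc k) (hits c T * 1/suc k)
    deviation≤Φ zero T ∣T∣≡ = ≤-trans (≤-reflexive (trans
        (cong (λ z → abs (hits c T * 1ℚ - p) + 1ℚ * z) (trans (ΣF.S-cong (λ s → *-zeroʳ (𝟙 T s))) (ΣF.S-0 {n})))
        (lem (abs (hits c T * 1ℚ - p)))))
      (Φ-1 (hits c T * 1ℚ))
      where
      lem : ∀ a → a + 1ℚ * 0ℚ ≡ a
      lem = solve-∀ ℚ-ring
    deviation≤Φ (suc j) T ∣T∣≡ = begin
      abs (x - p) + w * sumFin (λ s → 𝟙 T s * deviation k (T ∖ s))
        ≤⟨ +-monoʳ-≤ (abs (x - p)) (*-mono-nonneg (0≤1/n (suc k)) (ΣF.S-mono (λ s → 𝟙*-mono T s (branch s)))) ⟩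
      abs (x - p) + w * sumFin (λ s → 𝟙 T s * ((1ℚ - c s) * X₀ + c s * X₁))
        ≡⟨ cong (λ z → abs (x - p) + w * z) total ⟩
      abs (x - p) + w * (((1ℚ + ℕtoℚ k) - h) * X₀ + h * X₁)
        ≡⟨ cong (abs (x - p) +_) (trans (lem w (1ℚ + ℕtoℚ k) h X₀ X₁) (cong (λ z → (z - x) * X₀ + x * X₁) ([1+k]/[1+k] k))) ⟩
      abs (x - p) + ((1ℚ - x) * X₀ + x * X₁)
        ≤⟨ Φ-step j x ⟩
      Φ (suc k) x ∎
      where
      open ≤-Reasoning
      k = suc j
      w = 1/suc k
      u = 1/suc j
      h = hits c T
      x = h * w
      X₀ = Φ k (x + x * u)
      X₁ = Φ k (x + (x - 1ℚ) * u)
      lem : ∀ w K h a b → w * ((K - h) * a + h * b) ≡ (K * w - h * w) * a + (h * w) * b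
      lem = solve-∀ ℚ-ring
      h≡ : h ≡ x + x * ℕtoℚ k
      h≡ = trans (sym (*-identityʳ h)) (trans (cong (h *_) (sym ([1+k]/[1+k] k))) (lem₁ h (ℕtoℚ k) w))
        where
        lem₁ : ∀ h K w → h * ((1ℚ + K) * w) ≡ h * w + (h * w) * K
        lem₁ = solve-∀ ℚ-ring
      -- Here `h` is x (k + 1), and k u = 1; a = 0 and a = 1 give the two arguments occurring in
      -- `Φ-step`.
      location : ∀ a → (h - a) * u ≡ x + (x - a) * u
      location a = trans (cong (λ z → (z - a) * u) h≡) (trans (lem₁ x (ℕtoℚ k) a u)
        (trans (cong (λ z → x * z + (x - a) * u) (n*[1/n]≡1 k)) (cong (_+ (x - a) * u) (*-identityʳ x))))
        where
        lem₁ : ∀ x K a u → ((x + x * K) - a) * u ≡ x * (K * u) + (x - a) * u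
        lem₁ = solve-∀ ℚ-ring
      branch : ∀ s → s ∈ T → deviation k (T ∖ s) ≤ (1ℚ - c s) * X₀ + c s * X₁
      branch s s∈T = ≤-trans (deviation≤Φ j (T ∖ s) (ℕ.suc-injective (trans (sym (∣T∣≡1+∣T∖s∣ s∈T)) ∣T∣≡)))
        (≤-reflexive (trans (cong (λ z → Φ k (z * u)) (sum-𝟙-∖ c s∈T))
          (trans (cong (Φ k) (location (c s)))
          (trans (mix-01 (λ a → Φ k (x + (x - a) * u)) (c01 s))
            (cong (λ z → (1ℚ - c s) * Φ k (x + z * u) + c s * X₁) (+-identityʳ x))))))
      total : sumFin (λ s → 𝟙 T s * ((1ℚ - c s) * X₀ + c s * X₁)) ≡ ((1ℚ + ℕtoℚ k) - h) * X₀ + h * X₁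
      total = begin-equality
        sumFin (λ s → 𝟙 T s * ((1ℚ - c s) * X₀ + c s * X₁))
          ≡⟨ ΣF.S-cong (λ s → lem₁ (𝟙 T s) (c s) X₀ X₁) ⟩
        sumFin (λ s → (𝟙 T s - 𝟙 T s * c s) * X₀ + (𝟙 T s * c s) * X₁)
          ≡⟨ trans (ΣF.S-+ (λ s → (𝟙 T s - 𝟙 T s * c s) * X₀) (λ s → (𝟙 T s * c s) * X₁))
               (cong₂ _+_ (ΣF.S-*ʳ (λ s → 𝟙 T s - 𝟙 T s * c s) X₀) (ΣF.S-*ʳ (λ s → 𝟙 T s * c s) X₁)) ⟩
        sumFin (λ s → 𝟙 T s - 𝟙 T s * c s) * X₀ + h * X₁
          ≡⟨ cong (λ z → z * X₀ + h * X₁) (trans (ΣF.S-- (𝟙 T) (λ s → 𝟙 T s * c s))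
               (cong (_- h) (trans (sum-𝟙 T) (trans (cong ℕtoℚ ∣T∣≡) (ℕtoℚ-suc k))))) ⟩
        ((1ℚ + ℕtoℚ k) - h) * X₀ + h * X₁ ∎
        where
        lem₁ : ∀ i c a b → i * ((1ℚ - c) * a + c * b) ≡ (i - i * c) * a + (i * c) * b
        lem₁ = solve-∀ ℚ-ring

  deviation-bound : ∀ {s r} → 0ℚ ≤ s → 0ℚ ≤ r → r * s ≡ 1ℚ → deviation n ⊤ ≤ (ℕtoℚ n * v) * r + s
  deviation-bound {s} {r} 0≤s 0≤r rs≡1 = begin
    deviation n ⊤
      ≤⟨ deviation≤Φ α τ 0≤α 0≤τ ατ≡1 n′ ⊤ (∣⊤∣≡n n) ⟩
    Φ n (hits c ⊤ * w)
      ≡⟨ cong (λ z → Φ n (z * w)) (ΣF.S-cong (λ i → trans (cong (_* c i) (𝟙-⊤ i)) (*-identityˡ (c i)))) ⟩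
    Φ n p
      ≤⟨ Φ-final n 0≤v ⟩
    v * (α * γ n) + τ * (ℕtoℚ n * β n)
      ≡⟨ lem v (ℕtoℚ n) (β n) r (γ n) s w ⟩
    (ℕtoℚ n * v) * r * (γ n * β n) + s * (γ n * β n) * (ℕtoℚ n * w)
      ≡⟨ cong₂ (λ a b → (ℕtoℚ n * v) * r * a + s * a * b) (γβ≡1 n) (n*[1/n]≡1 n) ⟩
    (ℕtoℚ n * v) * r * 1ℚ + s * 1ℚ * 1ℚ
      ≡⟨ lem₁ ((ℕtoℚ n * v) * r) s ⟩
    (ℕtoℚ n * v) * r + s ∎
    where
    open ≤-Reasoning
    w = 1/suc n′
    α τ : ℚ
    -- Solved from the two terms of `Φ-final`: with γ n β n = 1 they become exactly n v r and s. The
    -- product α τ is then r s = 1.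
    α = (ℕtoℚ n * β n) * r
    τ = (s * γ n) * w
    0≤α = *-nonneg (*-nonneg (0≤ℕtoℚ n) (<⇒≤ (0<β n))) 0≤r
    0≤τ = *-nonneg (*-nonneg 0≤s (0≤γ n)) (0≤1/n n)
    ατ≡1 : α * τ ≡ 1ℚ
    ατ≡1 = trans (lem₂ (ℕtoℚ n) (β n) r s (γ n) w)
      (trans (cong₂ _*_ (cong₂ _*_ (n*[1/n]≡1 n) (γβ≡1 n)) rs≡1) refl)
      where
      lem₂ : ∀ n b r s g w → ((n * b) * r) * ((s * g) * w) ≡ ((n * w) * (g * b)) * (r * s)
      lem₂ = solve-∀ ℚ-ring
    open Potential p α τ 0≤α 0≤τ ατ≡1
    lem : ∀ v n b r g s w → v * (((n * b) * r) * g) + ((s * g) * w) * (n * b) ≡ (n * v) * r * (g * b) + s * (g * b) * (n * w)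
    lem = solve-∀ ℚ-ring
    lem₁ : ∀ a s → a * 1ℚ + s * 1ℚ * 1ℚ ≡ a + s
    lem₁ = solve-∀ ℚ-ring

-- Moments of the request imbalance

[1/_]^_ : ∀ n .{{_ : ℕ.NonZero n}} → ℕ → ℚ
[1/ n ]^ zero  = 1ℚ
[1/ n ]^ suc k = (pos 1 / n) * [1/ n ]^ k

0≤[1/n]^ : ∀ n .{{nz : ℕ.NonZero n}} k → 0ℚ ≤ [1/ n ]^ k
0≤[1/n]^ n zero    = nonNegative⁻¹ 1ℚ
0≤[1/n]^ n (suc k) = *-nonneg (0≤1/n n) (0≤[1/n]^ n k)

-- The weight stays inside the sum to match the shape of `expectedOPT`.
𝔼 : ∀ n .{{_ : ℕ.NonZero n}} k → (Vec (Fin n) k → ℚ) → ℚ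
𝔼 n k f = sumVec k (λ v → [1/ n ]^ k * f v)

𝔼-isSum : ∀ n .{{nz : ℕ.NonZero n}} k → IsSum (𝔼 n k)
𝔼-isSum n k = record
  { S-cong = λ h → V.S-cong (λ v → cong ([1/ n ]^ k *_) (h v))
  ; S-+    = λ f g → trans (V.S-cong (λ v → *-distribˡ-+ ([1/ n ]^ k) (f v) (g v))) (V.S-+ (λ v → [1/ n ]^ k * f v) (λ v → [1/ n ]^ k * g v))
  ; S-*    = λ c f → trans (V.S-cong (λ v → lem ([1/ n ]^ k) c (f v))) (V.S-* c (λ v → [1/ n ]^ k * f v))
  ; S-mono = λ h → V.S-mono (λ v → *-mono-nonneg (0≤[1/n]^ n k) (h v)) }
  where
  module V = IsSum (sumVec-isSum {n} k)
  lem : ∀ w c x → w * (c * x) ≡ c * (w * x)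
  lem = solve-∀ ℚ-ring

𝔼-suc : ∀ n .{{nz : ℕ.NonZero n}} k f → 𝔼 n (suc k) f ≡ (pos 1 / n) * sumFin (λ a → 𝔼 n k (λ v → f (a ∷ v)))
𝔼-suc n k f = trans
  (ΣF.S-cong (λ a → trans (ΣV.S-cong k (λ v → *-assoc (pos 1 / n) ([1/ n ]^ k) (f (a ∷ v)))) (ΣV.S-* k (pos 1 / n) (λ v → [1/ n ]^ k * f (a ∷ v)))))
  (ΣF.S-* (pos 1 / n) (λ a → 𝔼 n k (λ v → f (a ∷ v))))

𝔼-1 : ∀ n .{{nz : ℕ.NonZero n}} k → 𝔼 n k (λ _ → 1ℚ) ≡ 1ℚ
𝔼-1 n zero    = refl
𝔼-1 n (suc k) = trans (𝔼-suc n k (λ _ → 1ℚ)) (trans (cong ((pos 1 / n) *_)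
  (trans (ΣF.S-cong {n} (λ _ → 𝔼-1 n k)) (trans (sumFin-const n 1ℚ) (*-identityʳ (ℕtoℚ n)))))
  (trans (*-comm (pos 1 / n) (ℕtoℚ n)) (n*[1/n]≡1 n)))

module Moments {n′ : ℕ} (c : Fin (suc n′) → ℚ) (c01 : Is01 c) where
  open Sampling c c01

  Y : ∀ {k} → Vec (Fin n) k → ℚ
  Y v = sumFin (λ j → c (lookup v j) - p)

  Y² Y³ Y⁴ : ∀ {k} → Vec (Fin n) k → ℚ
  Y² v = Y v * Y v
  Y³ v = Y v * Y² v
  Y⁴ v = Y v * Y³ v

  private
    𝔼-linear : ∀ k a₀ a₁ a₂ a₃ →
      𝔼 n k (λ v → a₀ * 1ℚ + (a₁ * Y v + (a₂ * Y² v + (a₃ * Y³ v + Y⁴ v)))) ≡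
      a₀ * 1ℚ + (a₁ * 𝔼 n k Y + (a₂ * 𝔼 n k Y² + (a₃ * 𝔼 n k Y³ + 𝔼 n k Y⁴)))
    𝔼-linear k a₀ a₁ a₂ a₃ =
      trans (S-+ (λ _ → a₀ * 1ℚ) (λ v → a₁ * Y v + (a₂ * Y² v + (a₃ * Y³ v + Y⁴ v))))
      (cong₂ _+_ (trans (S-* a₀ (λ _ → 1ℚ)) (cong (a₀ *_) (𝔼-1 n k)))
      (trans (S-+ (λ v → a₁ * Y v) (λ v → a₂ * Y² v + (a₃ * Y³ v + Y⁴ v)))
      (cong₂ _+_ (S-* a₁ Y)
      (trans (S-+ (λ v → a₂ * Y² v) (λ v → a₃ * Y³ v + Y⁴ v))
      (cong₂ _+_ (S-* a₂ Y²)
      (trans (S-+ (λ v → a₃ * Y³ v) Y⁴)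
      (cong (_+ 𝔼 n k Y⁴) (S-* a₃ Y³))))))))
      where open IsSum (𝔼-isSum n k)

    𝔼-quadratic : ∀ k a₀ a₁ →
      𝔼 n k (λ v → a₀ * 1ℚ + (a₁ * Y v + Y² v)) ≡ a₀ * 1ℚ + (a₁ * 𝔼 n k Y + 𝔼 n k Y²)
    𝔼-quadratic k a₀ a₁ =
      trans (S-+ (λ _ → a₀ * 1ℚ) (λ v → a₁ * Y v + Y² v))
      (cong₂ _+_ (trans (S-* a₀ (λ _ → 1ℚ)) (cong (a₀ *_) (𝔼-1 n k)))
      (trans (S-+ (λ v → a₁ * Y v) Y²)
      (cong (_+ 𝔼 n k Y²) (S-* a₁ Y))))
      where open IsSum (𝔼-isSum n k)

    one-draw : ∀ (g : ℚ → ℚ) → (pos 1 / n) * sumFin (λ a → g (c a)) ≡ (1ℚ - p) * g 0ℚ + p * g 1ℚ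
    one-draw g = begin
      w * sumFin (λ a → g (c a))
        ≡⟨ cong (w *_) (trans (ΣF.S-cong (λ a → mix-01 g (c01 a)))
             (trans (ΣF.S-+ (λ a → (1ℚ - c a) * g 0ℚ) (λ a → c a * g 1ℚ))
               (cong₂ _+_ (trans (ΣF.S-*ʳ (λ a → 1ℚ - c a) (g 0ℚ)) (cong (_* g 0ℚ) sum-1-c)) (ΣF.S-*ʳ c (g 1ℚ))))) ⟩
      w * ((ℕtoℚ n - sumFin c) * g 0ℚ + sumFin c * g 1ℚ)
        ≡⟨ lem w (ℕtoℚ n) (sumFin c) (g 0ℚ) (g 1ℚ) ⟩
      (ℕtoℚ n * w - sumFin c * w) * g 0ℚ + sumFin c * w * g 1ℚ
        ≡⟨ cong (λ z → (z - p) * g 0ℚ + p * g 1ℚ) (n*[1/n]≡1 n) ⟩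
      (1ℚ - p) * g 0ℚ + p * g 1ℚ ∎
      where
      open ≡-Reasoning
      w = 1/suc n′
      lem : ∀ w n s a b → w * ((n - s) * a + s * b) ≡ (n * w - s * w) * a + s * w * b
      lem = solve-∀ ℚ-ring

  𝔼Y≡0 : ∀ k → 𝔼 n k Y ≡ 0ℚ
  𝔼Y≡0 zero    = refl
  𝔼Y≡0 (suc k) = begin
    𝔼 n (suc k) Y
      ≡⟨ 𝔼-suc n k Y ⟩
    (pos 1 / n) * sumFin (λ a → 𝔼 n k (λ v → (c a - p) + Y v))
      ≡⟨ cong ((pos 1 / n) *_) (ΣF.S-cong (λ a → inner a)) ⟩
    (pos 1 / n) * sumFin (λ a → (c a - p) * 1ℚ + 0ℚ)
      ≡⟨ one-draw (λ z → (z - p) * 1ℚ + 0ℚ) ⟩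
    (1ℚ - p) * ((0ℚ - p) * 1ℚ + 0ℚ) + p * ((1ℚ - p) * 1ℚ + 0ℚ)
      ≡⟨ lem p ⟩
    0ℚ ∎
    where
    open ≡-Reasoning
    module 𝔼S = IsSum (𝔼-isSum n k)
    lem : ∀ p → (1ℚ - p) * ((0ℚ - p) * 1ℚ + 0ℚ) + p * ((1ℚ - p) * 1ℚ + 0ℚ) ≡ 0ℚ
    lem = solve-∀ ℚ-ring
    inner : ∀ a → 𝔼 n k (λ v → (c a - p) + Y v) ≡ (c a - p) * 1ℚ + 0ℚ
    inner a = trans (𝔼S.S-cong (λ v → cong (_+ Y v) (sym (*-identityʳ (c a - p)))))
      (trans (𝔼S.S-+ (λ v → (c a - p) * 1ℚ) Y) (cong₂ _+_ (trans (𝔼S.S-* (c a - p) (λ _ → 1ℚ)) (cong ((c a - p) *_) (𝔼-1 n k))) (𝔼Y≡0 k)))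

  𝔼Y² : ∀ k → 𝔼 n k Y² ≡ ℕtoℚ k * v
  𝔼Y² zero    = sym (*-zeroˡ v)
  𝔼Y² (suc k) = begin
    𝔼 n (suc k) Y²
      ≡⟨ 𝔼-suc n k Y² ⟩
    (pos 1 / n) * sumFin (λ a → 𝔼 n k (λ v → ((c a - p) + Y v) * ((c a - p) + Y v)))
      ≡⟨ cong ((pos 1 / n) *_) (ΣF.S-cong (λ a → trans (𝔼S.S-cong (λ v → lem₁ (c a - p) (Y v)))
           (trans (𝔼-quadratic k ((c a - p) * (c a - p)) ((c a - p) + (c a - p)))
             (cong₂ (λ x y → (c a - p) * (c a - p) * 1ℚ + (((c a - p) + (c a - p)) * x + y)) (𝔼Y≡0 k) (𝔼Y² k))))) ⟩
    (pos 1 / n) * sumFin (λ a → (c a - p) * (c a - p) * 1ℚ + (((c a - p) + (c a - p)) * 0ℚ + ℕtoℚ k * v))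
      ≡⟨ one-draw (λ z → (z - p) * (z - p) * 1ℚ + (((z - p) + (z - p)) * 0ℚ + ℕtoℚ k * v)) ⟩
    (1ℚ - p) * ((0ℚ - p) * (0ℚ - p) * 1ℚ + (((0ℚ - p) + (0ℚ - p)) * 0ℚ + ℕtoℚ k * v))
      + p * ((1ℚ - p) * (1ℚ - p) * 1ℚ + (((1ℚ - p) + (1ℚ - p)) * 0ℚ + ℕtoℚ k * v))
      ≡⟨ lem₂ p (ℕtoℚ k) ⟩
    (1ℚ + ℕtoℚ k) * v
      ≡⟨ cong (_* v) (ℕtoℚ-suc k) ⟨
    ℕtoℚ (suc k) * v ∎
    where
    open ≡-Reasoning
    module 𝔼S = IsSum (𝔼-isSum n k)
    lem₁ : ∀ x y → (x + y) * (x + y) ≡ x * x * 1ℚ + ((x + x) * y + y * y)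
    lem₁ = solve-∀ ℚ-ring
    lem₂ : ∀ p K → (1ℚ - p) * ((0ℚ - p) * (0ℚ - p) * 1ℚ + (((0ℚ - p) + (0ℚ - p)) * 0ℚ + K * (p * (1ℚ - p))))
      + p * ((1ℚ - p) * (1ℚ - p) * 1ℚ + (((1ℚ - p) + (1ℚ - p)) * 0ℚ + K * (p * (1ℚ - p)))) ≡ (1ℚ + K) * (p * (1ℚ - p))
    lem₂ = solve-∀ ℚ-ring

  -- Expand the fourth power of a new centred draw plus `Y`. The terms in 𝔼 Y and 𝔼 Y³ cancel
  -- because 𝔼 Y = 0 and the draw has mean zero, so `𝔼 n k Y³` can stay an opaque variable. What is
  -- added is 6 k v² and the fourth central moment v (1 - 3 v) of a Bernoulli(p).
  𝔼Y⁴ : ∀ k → 𝔼 n k Y⁴ ≡ ℕtoℚ 3 * (ℕtoℚ k * (ℕtoℚ k - 1ℚ)) * (v * v) + ℕtoℚ k * (v * (1ℚ - ℕtoℚ 3 * v))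
  𝔼Y⁴ zero    = sym (lem v)
    where
    lem : ∀ v → ℕtoℚ 3 * (0ℚ * (0ℚ - 1ℚ)) * (v * v) + 0ℚ * (v * (1ℚ - ℕtoℚ 3 * v)) ≡ 0ℚ
    lem = solve-∀ ℚ-ring
  𝔼Y⁴ (suc k) = begin
    𝔼 n (suc k) Y⁴
      ≡⟨ 𝔼-suc n k Y⁴ ⟩
    (pos 1 / n) * sumFin (λ a → 𝔼 n k (λ v → ((c a - p) + Y v) * (((c a - p) + Y v) * (((c a - p) + Y v) * ((c a - p) + Y v)))))
      ≡⟨ cong ((pos 1 / n) *_) (ΣF.S-cong (λ a → trans (𝔼S.S-cong (λ v → lem₁ (c a - p) (Y v)))
           (trans (𝔼-linear k (c₀ (c a - p)) (c₁ (c a - p)) (c₂ (c a - p)) (c₃ (c a - p)))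
             (cong₂ (λ x y → c₀ (c a - p) * 1ℚ + (c₁ (c a - p) * x + (c₂ (c a - p) * y + (c₃ (c a - p) * 𝔼 n k Y³ + 𝔼 n k Y⁴)))) (𝔼Y≡0 k) (𝔼Y² k))))) ⟩
    (pos 1 / n) * sumFin (λ a → G (c a))
      ≡⟨ one-draw G ⟩
    (1ℚ - p) * G 0ℚ + p * G 1ℚ
      ≡⟨ lem₂ p (ℕtoℚ k) (𝔼 n k Y³) (𝔼 n k Y⁴) ⟩
    𝔼 n k Y⁴ + (ℕtoℚ 6 * (ℕtoℚ k * (v * v)) + v * (1ℚ - ℕtoℚ 3 * v))
      ≡⟨ cong (_+ (ℕtoℚ 6 * (ℕtoℚ k * (v * v)) + v * (1ℚ - ℕtoℚ 3 * v))) (𝔼Y⁴ k) ⟩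
    (ℕtoℚ 3 * (ℕtoℚ k * (ℕtoℚ k - 1ℚ)) * (v * v) + ℕtoℚ k * (v * (1ℚ - ℕtoℚ 3 * v))) + (ℕtoℚ 6 * (ℕtoℚ k * (v * v)) + v * (1ℚ - ℕtoℚ 3 * v))
      ≡⟨ lem₃ (ℕtoℚ k) v ⟩
    ℕtoℚ 3 * ((1ℚ + ℕtoℚ k) * ((1ℚ + ℕtoℚ k) - 1ℚ)) * (v * v) + (1ℚ + ℕtoℚ k) * (v * (1ℚ - ℕtoℚ 3 * v))
      ≡⟨ cong (λ K → ℕtoℚ 3 * (K * (K - 1ℚ)) * (v * v) + K * (v * (1ℚ - ℕtoℚ 3 * v))) (ℕtoℚ-suc k) ⟨
    ℕtoℚ 3 * (ℕtoℚ (suc k) * (ℕtoℚ (suc k) - 1ℚ)) * (v * v) + ℕtoℚ (suc k) * (v * (1ℚ - ℕtoℚ 3 * v)) ∎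
    where
    open ≡-Reasoning
    module 𝔼S = IsSum (𝔼-isSum n k)
    c₀ c₁ c₂ c₃ : ℚ → ℚ
    c₀ x = x * (x * (x * x))
    c₁ x = ℕtoℚ 4 * (x * (x * x))
    c₂ x = ℕtoℚ 6 * (x * x)
    c₃ x = ℕtoℚ 4 * x
    G : ℚ → ℚ
    G z = c₀ (z - p) * 1ℚ + (c₁ (z - p) * 0ℚ + (c₂ (z - p) * (ℕtoℚ k * v) + (c₃ (z - p) * 𝔼 n k Y³ + 𝔼 n k Y⁴)))
    lem₁ : ∀ x y → (x + y) * ((x + y) * ((x + y) * (x + y))) ≡
      x * (x * (x * x)) * 1ℚ + (ℕtoℚ 4 * (x * (x * x)) * y + (ℕtoℚ 6 * (x * x) * (y * y) + (ℕtoℚ 4 * x * (y * (y * y)) + y * (y * (y * y)))))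
    lem₁ = solve-∀ ℚ-ring
    lem₂ : ∀ p K m₃ m₄ →
      (1ℚ - p) * ((0ℚ - p) * ((0ℚ - p) * ((0ℚ - p) * (0ℚ - p))) * 1ℚ + (ℕtoℚ 4 * ((0ℚ - p) * ((0ℚ - p) * (0ℚ - p))) * 0ℚ + (ℕtoℚ 6 * ((0ℚ - p) * (0ℚ - p)) * (K * (p * (1ℚ - p))) + (ℕtoℚ 4 * (0ℚ - p) * m₃ + m₄))))
      + p * ((1ℚ - p) * ((1ℚ - p) * ((1ℚ - p) * (1ℚ - p))) * 1ℚ + (ℕtoℚ 4 * ((1ℚ - p) * ((1ℚ - p) * (1ℚ - p))) * 0ℚ + (ℕtoℚ 6 * ((1ℚ - p) * (1ℚ - p)) * (K * (p * (1ℚ - p))) + (ℕtoℚ 4 * (1ℚ - p) * m₃ + m₄))))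
      ≡ m₄ + (ℕtoℚ 6 * (K * ((p * (1ℚ - p)) * (p * (1ℚ - p)))) + (p * (1ℚ - p)) * (1ℚ - ℕtoℚ 3 * (p * (1ℚ - p))))
    lem₂ = solve-∀ ℚ-ring
    lem₃ : ∀ K v → (ℕtoℚ 3 * (K * (K - 1ℚ)) * (v * v) + K * (v * (1ℚ - ℕtoℚ 3 * v))) + (ℕtoℚ 6 * (K * (v * v)) + v * (1ℚ - ℕtoℚ 3 * v))
      ≡ ℕtoℚ 3 * ((1ℚ + K) * ((1ℚ + K) - 1ℚ)) * (v * v) + (1ℚ + K) * (v * (1ℚ - ℕtoℚ 3 * v))
    lem₃ = solve-∀ ℚ-ring

-- Bounding the first absolute moment from below

sum-quadratic : ∀ {A : Set} {S : (A → ℚ) → ℚ} → IsSum S → (f g : A → ℚ) → (∀ x → 0ℚ ≤ f x) → ∀ s t →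
  0ℚ ≤ s * s * S f + (- (s * t + s * t) * S (λ x → f x * g x) + t * t * S (λ x → f x * (g x * g x)))
sum-quadratic {S = S} S-isSum f g 0≤f s t = subst (0ℚ ≤_)
  (trans (S-cong (λ x → lem (f x) (g x) s t))
    (trans (S-+ (λ x → s * s * f x) (λ x → - (s * t + s * t) * (f x * g x) + t * t * (f x * (g x * g x))))
      (cong₂ _+_ (S-* (s * s) f) (trans (S-+ (λ x → - (s * t + s * t) * (f x * g x)) (λ x → t * t * (f x * (g x * g x))))
        (cong₂ _+_ (S-* (- (s * t + s * t)) (λ x → f x * g x)) (S-* (t * t) (λ x → f x * (g x * g x))))))))
  -- Cauchy-Schwarz before optimisation: the form is `S` applied to f (s - t g)². Keeping s and t as
  -- a homogeneous pair avoids a division.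
  (S-nonneg (λ x → *-nonneg (0≤f x) (square-nonneg (s - t * g x))))
  where
  open IsSum S-isSum
  lem : ∀ f g s t → f * ((s - t * g) * (s - t * g)) ≡ s * s * f + (- (s * t + s * t) * (f * g) + t * t * (f * (g * g)))
  lem = solve-∀ ℚ-ring

-- B, S, C, D stand for the first four absolute moments of a random variable.  Hölder gives S³ ≤ B² D;
-- the choices (s , t) = (S , B) and (4 B , 1) in the two quadratic forms avoid the square roots in it.
second≤4*first² : ∀ {B S C D} → 0ℚ ≤ B → 0ℚ < S → D ≤ ℕtoℚ 4 * (S * S) →
  (∀ s t → 0ℚ ≤ s * s * B + (- (s * t + s * t) * S + t * t * C)) →
  (∀ s t → 0ℚ ≤ s * s * S + (- (s * t + s * t) * C + t * t * D)) →
  S ≤ ℕtoℚ 4 * (B * B)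
second≤4*first² {B} {S} {C} {D} 0≤B 0<S D≤4S² quad₁ quad₂ with <-cmp 0ℚ B
... | tri> _ _ B<0 = contradiction (<-≤-trans B<0 0≤B) (<-irrefl refl)
-- A zero first moment is incompatible with S > 0: the pair (1 , 1) gives C ≥ 2 S, and (C , S) gives
-- S² C ≤ 0.
... | tri≈ _ refl _ = contradiction (<-≤-trans 0<S (≤-trans S≤C C≤0)) (<-irrefl refl)
  where
  S≤C : S ≤ C
  S≤C = ≤-by-gap (S + (1ℚ * 1ℚ * 0ℚ + (- (1ℚ * 1ℚ + 1ℚ * 1ℚ) * S + 1ℚ * 1ℚ * C))) (+-nonneg (<⇒≤ 0<S) (quad₁ 1ℚ 1ℚ)) (lem S C)
    where
    lem : ∀ S C → C ≡ S + (S + (1ℚ * 1ℚ * 0ℚ + (- (1ℚ * 1ℚ + 1ℚ * 1ℚ) * S + 1ℚ * 1ℚ * C)))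
    lem = solve-∀ ℚ-ring
  C≤0 : C ≤ 0ℚ
  C≤0 = *-cancel-pos (*-pos 0<S 0<S) (≤-by-gap (C * C * 0ℚ + (- (C * S + C * S) * S + S * S * C)) (quad₁ C S) (lem S C))
    where
    lem : ∀ S C → S * S * 0ℚ ≡ S * S * C + (C * C * 0ℚ + (- (C * S + C * S) * S + S * S * C))
    lem = solve-∀ ℚ-ring
-- Both pairs are read off the extremal case, where ∣Y∣ is 4 B with probability 1/4 and 0 otherwise:
-- there S / B = 4 B and D = 4 S², and s - t ∣Y∣ vanishes wherever ∣Y∣ does not. Adding 8 (B C - S²)
-- removes C.
... | tri< 0<B _ _ = *-cancel-pos (*-pos (0<ℕtoℚ 3) 0<S) (≤-by-gap
    ((4B * 4B * S + (- (4B * 1ℚ + 4B * 1ℚ) * C + 1ℚ * 1ℚ * D)) + (ℕtoℚ 8 * (B * C - S * S) + (ℕtoℚ 4 * (S * S) - D)))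
    (+-nonneg (quad₂ 4B 1ℚ) (+-nonneg (*-nonneg (0≤ℕtoℚ 8) (p≤q⇒0≤q-p S²≤BC)) (p≤q⇒0≤q-p D≤4S²)))
    (lem B S C D))
  where
  4B = ℕtoℚ 4 * B
  S²≤BC : S * S ≤ B * C
  S²≤BC = *-cancel-pos 0<B (≤-by-gap (S * S * B + (- (S * B + S * B) * S + B * B * C)) (quad₁ S B) (lem₁ B S C))
    where
    lem₁ : ∀ B S C → B * (B * C) ≡ B * (S * S) + (S * S * B + (- (S * B + S * B) * S + B * B * C))
    lem₁ = solve-∀ ℚ-ring
  lem : ∀ B S C D → (ℕtoℚ 4 * S) * (ℕtoℚ 4 * (B * B)) ≡ (ℕtoℚ 4 * S) * S +
    (((ℕtoℚ 4 * B) * (ℕtoℚ 4 * B) * S + (- ((ℕtoℚ 4 * B) * 1ℚ + (ℕtoℚ 4 * B) * 1ℚ) * C + 1ℚ * 1ℚ * D)) + (ℕtoℚ 8 * (B * C - S * S) + (ℕtoℚ 4 * (S * S) - D)))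
  lem = solve-∀ ℚ-ring

-- The best s would be √S; 2 B is a rational substitute, and S ≤ 4 B² gives S / (2 B) ≤ 2 B. Since r
-- s = 1 excludes s = 0, the case B = 0 is treated apart.
bound-optimised : ∀ {A B S} → 0ℚ ≤ B → 0ℚ ≤ S → (0ℚ < S → S ≤ ℕtoℚ 4 * (B * B)) →
  (∀ {s r} → 0ℚ ≤ s → 0ℚ ≤ r → r * s ≡ 1ℚ → A ≤ S * r + s) → A ≤ ℕtoℚ 4 * B
bound-optimised {A} {B} {S} 0≤B 0≤S S≤4B² A≤ with <-cmp 0ℚ B
... | tri> _ _ B<0 = contradiction (<-≤-trans B<0 0≤B) (<-irrefl refl)
... | tri< 0<B _ _ = ≤-trans (A≤ (<⇒≤ 0<2B) 0≤r r*2B≡1) (≤-trans (+-monoˡ-≤ 2B (≤-trans (≤-reflexive (*-comm S r)) (*-mono-nonneg 0≤r S≤′)))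
    (≤-reflexive (trans (lem₁ r B) (trans (cong (λ z → z * 2B + 2B) r*2B≡1) (lem₂ B)))))
  where
  2B = ℕtoℚ 2 * B
  0<2B : 0ℚ < 2B
  0<2B = *-pos (0<ℕtoℚ 1) 0<B
  r = proj₁ (inverse 0<2B)
  0≤r = proj₁ (proj₂ (inverse 0<2B))
  r*2B≡1 = proj₂ (proj₂ (inverse 0<2B))
  S≤′ : S ≤ ℕtoℚ 4 * (B * B)
  S≤′ with <-cmp 0ℚ S
  ... | tri< 0<S _ _ = S≤4B² 0<S
  ... | tri≈ _ 0≡S _ = subst (_≤ ℕtoℚ 4 * (B * B)) 0≡S (*-nonneg (0≤ℕtoℚ 4) (square-nonneg B))
  ... | tri> _ _ S<0 = contradiction (<-≤-trans S<0 0≤S) (<-irrefl refl)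
  lem₁ : ∀ r B → r * (ℕtoℚ 4 * (B * B)) + ℕtoℚ 2 * B ≡ (r * (ℕtoℚ 2 * B)) * (ℕtoℚ 2 * B) + ℕtoℚ 2 * B
  lem₁ = solve-∀ ℚ-ring
  lem₂ : ∀ B → 1ℚ * (ℕtoℚ 2 * B) + ℕtoℚ 2 * B ≡ ℕtoℚ 4 * B
  lem₂ = solve-∀ ℚ-ring
... | tri≈ _ refl _ with <-cmp 0ℚ A
...   | tri≈ _ 0≡A _ = ≤-reflexive (sym 0≡A)
...   | tri> _ _ A<0 = <⇒≤ A<0
...   | tri< 0<A _ _ = contradiction (<-≤-trans (*-pos (positive⁻¹ ½) 0<A) ½A≤0) (<-irrefl refl)
  where
  S≡0 : S ≡ 0ℚ
  S≡0 with <-cmp 0ℚ S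
  ... | tri< 0<S _ _ = contradiction (<-≤-trans 0<S (S≤4B² 0<S)) (<-irrefl refl)
  ... | tri≈ _ 0≡S _ = sym 0≡S
  ... | tri> _ _ S<0 = contradiction (<-≤-trans S<0 0≤S) (<-irrefl refl)
  -- With S = 0 the hypothesis reads A ≤ s for every s > 0, and s = A / 2 refutes A > 0.
  0<½A = *-pos (positive⁻¹ ½) 0<A
  r = proj₁ (inverse 0<½A)
  A≤½A : A ≤ ½ * A
  A≤½A = ≤-trans (A≤ (<⇒≤ 0<½A) (proj₁ (proj₂ (inverse 0<½A))) (proj₂ (proj₂ (inverse 0<½A))))
    (≤-reflexive (trans (cong (λ z → z * r + ½ * A) S≡0) (trans (cong (_+ ½ * A) (*-zeroˡ r)) (+-identityˡ (½ * A)))))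
  ½A≤0 : ½ * A ≤ 0ℚ
  ½A≤0 = ≤-by-gap (½ * A - A) (p≤q⇒0≤q-p A≤½A) (lem A)
    where
    lem : ∀ A → 0ℚ ≡ ½ * A + (½ * A - A)
    lem = solve-∀ ℚ-ring

ℕtoℚ-2≤ : ∀ {n} → 2 ℕ.≤ n → 0ℚ ≤ ℕtoℚ n - ℕtoℚ 2
ℕtoℚ-2≤ (s≤s (s≤s {n = k} z≤n)) = subst (0ℚ ≤_)
  (sym (trans (cong (_- ℕtoℚ 2) (trans (ℕtoℚ-suc (suc k)) (cong (1ℚ +_) (ℕtoℚ-suc k)))) (lem (ℕtoℚ k)))) (0≤ℕtoℚ k)
  where
  lem : ∀ K → 1ℚ + (1ℚ + K) - ℕtoℚ 2 ≡ K
  lem = solve-∀ ℚ-ring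

-- The comparison on one edge

module Comparison {n′ : ℕ} (2≤n : 2 ℕ.≤ suc n′) (c : Fin (suc n′) → ℚ) (c01 : Is01 c) where
  open Sampling c c01
  open Moments c c01

  private
    S = ℕtoℚ n * v
    a = sumFin c
    b = sumFin (λ i → 1ℚ - c i)

    0≤n-2 : 0ℚ ≤ ℕtoℚ n - ℕtoℚ 2
    0≤n-2 = ℕtoℚ-2≤ 2≤n

    a+b≡n : a + b ≡ ℕtoℚ n
    a+b≡n = trans (cong (a +_) sum-1-c) (lem a (ℕtoℚ n))
      where
      lem : ∀ a n → a + (n - a) ≡ n
      lem = solve-∀ ℚ-ring

    n²v≡ab : ℕtoℚ n * S ≡ a * b
    n²v≡ab = trans (lem (ℕtoℚ n) p) (cong₂ _*_ n*p≡sum n*[1-p]≡sum)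
      where
      lem : ∀ n p → n * (n * (p * (1ℚ - p))) ≡ (n * p) * (n * (1ℚ - p))
      lem = solve-∀ ℚ-ring

    ab≢0 : 0ℚ < S → a * b ≢ 0ℚ
    ab≢0 0<S ab≡0 = <-irrefl (sym (trans n²v≡ab ab≡0)) (*-pos (0<ℕtoℚ n′) 0<S)

    1≤a : 0ℚ < S → 1ℚ ≤ a
    1≤a 0<S with sum-01 c c01
    ... | inj₁ a≡0 = contradiction (trans (cong (_* b) a≡0) (*-zeroˡ b)) (ab≢0 0<S)
    ... | inj₂ 1≤a = 1≤a

    1≤b : 0ℚ < S → 1ℚ ≤ b
    1≤b 0<S with sum-01 (λ i → 1ℚ - c i) (λ i → 1-01 (c01 i))
    ... | inj₁ b≡0 = contradiction (trans (cong (a *_) b≡0) (*-zeroʳ a)) (ab≢0 0<S)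
    ... | inj₂ 1≤b = 1≤b

    -- What `𝔼Y⁴≤4S²` needs, because 4 S² - 𝔼 Y⁴ = S (S + 6 v - 1). From a, b ≥ 1 and a + b = n
    -- follows n² v = a b ≥ n - 1; multiplied by n², the claim reduces to (n + 6) (n - 1) ≥ n²,
    -- whose slack 5 n - 6 is nonnegative by n ≥ 2.
    1≤S+6v : 0ℚ < S → 1ℚ ≤ S + ℕtoℚ 6 * v
    1≤S+6v 0<S = *-cancel-pos (*-pos (0<ℕtoℚ n′) (0<ℕtoℚ n′)) (≤-by-gap
      ((ℕtoℚ n + ℕtoℚ 6) * ((a - 1ℚ) * (b - 1ℚ)) + (ℕtoℚ 5 * (ℕtoℚ n - ℕtoℚ 2) + ℕtoℚ 4))
      (+-nonneg (*-nonneg (+-nonneg (0≤ℕtoℚ n) (0≤ℕtoℚ 6)) (*-nonneg (p≤q⇒0≤q-p (1≤a 0<S)) (p≤q⇒0≤q-p (1≤b 0<S))))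
                (+-nonneg (*-nonneg (0≤ℕtoℚ 5) 0≤n-2) (0≤ℕtoℚ 4)))
      (begin
        (ℕtoℚ n * ℕtoℚ n) * (S + ℕtoℚ 6 * v)
          ≡⟨ lem₁ (ℕtoℚ n) v ⟩
        (ℕtoℚ n + ℕtoℚ 6) * (ℕtoℚ n * S)
          ≡⟨ cong ((ℕtoℚ n + ℕtoℚ 6) *_) n²v≡ab ⟩
        (ℕtoℚ n + ℕtoℚ 6) * (a * b)
          ≡⟨ lem₂ (ℕtoℚ n) a b ⟩
        (ℕtoℚ n + ℕtoℚ 6) * ((a - 1ℚ) * (b - 1ℚ)) + (ℕtoℚ n + ℕtoℚ 6) * ((a + b) - 1ℚ)
          ≡⟨ cong (λ z → (ℕtoℚ n + ℕtoℚ 6) * ((a - 1ℚ) * (b - 1ℚ)) + (ℕtoℚ n + ℕtoℚ 6) * (z - 1ℚ)) a+b≡n ⟩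
        (ℕtoℚ n + ℕtoℚ 6) * ((a - 1ℚ) * (b - 1ℚ)) + (ℕtoℚ n + ℕtoℚ 6) * (ℕtoℚ n - 1ℚ)
          ≡⟨ lem₃ (ℕtoℚ n) ((ℕtoℚ n + ℕtoℚ 6) * ((a - 1ℚ) * (b - 1ℚ))) ⟩
        (ℕtoℚ n * ℕtoℚ n) * 1ℚ + ((ℕtoℚ n + ℕtoℚ 6) * ((a - 1ℚ) * (b - 1ℚ)) + (ℕtoℚ 5 * (ℕtoℚ n - ℕtoℚ 2) + ℕtoℚ 4)) ∎))
      where
      open ≡-Reasoning
      lem₁ : ∀ n v → (n * n) * (n * v + ℕtoℚ 6 * v) ≡ (n + ℕtoℚ 6) * (n * (n * v))
      lem₁ = solve-∀ ℚ-ring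
      lem₂ : ∀ n a b → (n + ℕtoℚ 6) * (a * b) ≡ (n + ℕtoℚ 6) * ((a - 1ℚ) * (b - 1ℚ)) + (n + ℕtoℚ 6) * ((a + b) - 1ℚ)
      lem₂ = solve-∀ ℚ-ring
      lem₃ : ∀ n y → y + (n + ℕtoℚ 6) * (n - 1ℚ) ≡ (n * n) * 1ℚ + (y + (ℕtoℚ 5 * (n - ℕtoℚ 2) + ℕtoℚ 4))
      lem₃ = solve-∀ ℚ-ring

    𝔼Y⁴≤4S² : 0ℚ < S → 𝔼 n n Y⁴ ≤ ℕtoℚ 4 * (S * S)
    𝔼Y⁴≤4S² 0<S = ≤-by-gap (S * ((S + ℕtoℚ 6 * v) - 1ℚ)) (*-nonneg (<⇒≤ 0<S) (p≤q⇒0≤q-p (1≤S+6v 0<S)))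
      (trans (lem (ℕtoℚ n) v) (cong (_+ S * ((S + ℕtoℚ 6 * v) - 1ℚ)) (sym (𝔼Y⁴ n))))
      where
      lem : ∀ n v → ℕtoℚ 4 * ((n * v) * (n * v)) ≡ (ℕtoℚ 3 * (n * (n - 1ℚ)) * (v * v) + n * (v * (1ℚ - ℕtoℚ 3 * v))) + (n * v) * (((n * v) + ℕtoℚ 6 * v) - 1ℚ)
      lem = solve-∀ ℚ-ring

    ∣Y∣ : Vec (Fin n) n → ℚ
    ∣Y∣ rs = abs (Y rs)

    module 𝔼S = IsSum (𝔼-isSum n n)

    𝔼∣Y∣² : 𝔼 n n (λ rs → ∣Y∣ rs * ∣Y∣ rs) ≡ S
    𝔼∣Y∣² = trans (𝔼S.S-cong (λ rs → abs-square (Y rs))) (𝔼Y² n)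

    𝔼∣Y∣⁴ : 𝔼 n n (λ rs → (∣Y∣ rs * ∣Y∣ rs) * (∣Y∣ rs * ∣Y∣ rs)) ≡ 𝔼 n n Y⁴
    𝔼∣Y∣⁴ = 𝔼S.S-cong (λ rs → trans (cong₂ _*_ (abs-square (Y rs)) (abs-square (Y rs))) (lem (Y rs)))
      where
      lem : ∀ y → (y * y) * (y * y) ≡ y * (y * (y * y))
      lem = solve-∀ ℚ-ring

    0≤∣Y∣ : ∀ rs → 0ℚ ≤ ∣Y∣ rs
    0≤∣Y∣ rs = 0≤∣p∣ (Y rs)

    S≤4B² : 0ℚ < S → S ≤ ℕtoℚ 4 * (𝔼 n n ∣Y∣ * 𝔼 n n ∣Y∣)
    S≤4B² 0<S = second≤4*first² {C = 𝔼 n n (λ rs → ∣Y∣ rs * (∣Y∣ rs * ∣Y∣ rs))} (𝔼S.S-nonneg 0≤∣Y∣) 0<S (𝔼Y⁴≤4S² 0<S)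
      (λ s t → subst (λ z → 0ℚ ≤ s * s * 𝔼 n n ∣Y∣ + (- (s * t + s * t) * z + t * t * 𝔼 n n (λ rs → ∣Y∣ rs * (∣Y∣ rs * ∣Y∣ rs)))) 𝔼∣Y∣²
        (sum-quadratic (𝔼-isSum n n) ∣Y∣ ∣Y∣ 0≤∣Y∣ s t))
      (λ s t → subst (0ℚ ≤_) (cong₂ _+_ (cong (s * s *_) 𝔼∣Y∣²)
          (cong₂ _+_ (cong (- (s * t + s * t) *_) (𝔼S.S-cong (λ rs → *-assoc (∣Y∣ rs) (∣Y∣ rs) (∣Y∣ rs)))) (cong (t * t *_) 𝔼∣Y∣⁴)))
        (sum-quadratic (𝔼-isSum n n) (λ rs → ∣Y∣ rs * ∣Y∣ rs) ∣Y∣ (λ rs → *-nonneg (0≤∣Y∣ rs) (0≤∣Y∣ rs)) s t))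

  deviation≤4𝔼∣Y∣ : deviation n ⊤ ≤ ℕtoℚ 4 * 𝔼 n n (λ rs → abs (Y rs))
  deviation≤4𝔼∣Y∣ = bound-optimised (𝔼S.S-nonneg 0≤∣Y∣) (*-nonneg (0≤ℕtoℚ n) 0≤v) S≤4B² deviation-bound

-- The weight in expectedOPT is a function local to Defs.  prodProb≡ leaves it to unification, which
-- succeeds once the number of servers is abstracted away from the number of remaining factors.
private
  expectedOPT-unfold : ∀ n .{{nz : ℕ.NonZero (suc n)}} (dist : Fin (suc n) → Fin (suc n) → ℚ) opt →
    Σ ℚ λ w → Matching.expectedOPT dist {{nz}} opt ≡ sumVec (suc n) (λ rs → (((pos 1 / suc n) {{nz}}) * w) * opt rs)
  expectedOPT-unfold n dist opt = _ , refl

  prodProb≡ : ∀ n .{{_ : ℕ.NonZero n}} (dist : Fin n → Fin n → ℚ) (opt : Vec (Fin n) n → ℚ) k → _ ≡ [1/ n ]^ k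

  weight≡ : ∀ n .{{nz : ℕ.NonZero (suc n)}} (dist : Fin (suc n) → Fin (suc n) → ℚ) opt →
    proj₁ (expectedOPT-unfold n {{nz}} dist opt) ≡ [1/_]^_ (suc n) {{nz}} n
  weight≡ n dist opt with suc n
  ... | N = prodProb≡ N dist opt n

  prodProb≡ n dist opt zero    = refl
  prodProb≡ n dist opt (suc k) = cong ((pos 1 / n) *_) (prodProb≡ n dist opt k)

expectedOPT≡𝔼 : ∀ n (dist : Fin (suc n) → Fin (suc n) → ℚ) opt → Matching.expectedOPT dist opt ≡ 𝔼 (suc n) (suc n) opt
expectedOPT≡𝔼 n dist opt = ΣV.S-cong (suc n) (λ rs → cong (λ w → ((pos 1 / suc n) * w) * opt rs) (weight≡ n dist opt))

-- Summation over the edges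

module Competitive {n′ : ℕ} (2≤n : 2 ℕ.≤ suc n′) {m : ℕ} (t : Tree m) (d : Fin (suc m) → Fin (suc m) → ℚ)
  (metric : IsShortestPathMetric t d) (loc : Fin (suc n′) → Fin (suc m)) where
  open Tree t
  open TreeMetric t d metric
  n = suc n′

  dist : Fin n → Fin n → ℚ
  dist i j = d (loc i) (loc j)

  open Matching dist

  below : Fin m → Fin n → ℚ
  below e = χ e ∘ loc

  module Sample (e : Fin m) = Sampling (below e) (λ i → χ-01 e (loc i))
  module Moment (e : Fin m) = Moments (below e) (λ i → χ-01 e (loc i))
  module Compare (e : Fin m) = Comparison 2≤n (below e) (λ i → χ-01 e (loc i))

  -- The length-weighted sum of the edge deviations obeys the recursion of the algorithm's cost,
  -- with the LP optimum replaced by its tree bound; it is thus a supersolution for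
  -- `ALG-from-bound`.
  ALG≤deviation : (X : Subset n → Fin n → Fin n → ℚ) → (∀ T → Nonempty T → Optimal T (X T)) →
    FairBias.expectedALG X ≤ sumFin (λ e → len e * Sample.deviation e n ⊤)
  ALG≤deviation X optimal = ALG-from-bound dist X optimal Φ base step n ⊤ (∣⊤∣≡n n)
    where
    Φ : ℕ → Subset n → ℚ
    Φ k T = sumFin (λ e → len e * Sample.deviation e k T)
    base : ∀ T → 0ℚ ≤ Φ 0 T
    base T = ΣF.S-nonneg (λ e → *-nonneg (len≥0 e) ≤-refl)
    step : ∀ k T → ∣ T ∣ ≡ suc k → objective T (X T) + 1/suc k * sumFin (λ s → 𝟙 T s * Φ k (T ∖ s)) ≤ Φ (suc k) T
    step k T ∣T∣≡ = begin
      objective T (X T) + 1/suc k * sumFin (λ s → 𝟙 T s * Φ k (T ∖ s))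
        ≤⟨ +-mono-≤ (objective≤treeCost t d metric loc T ∣T∣≡ (X T) (optimal T (∣T∣≡suc⇒nonempty T ∣T∣≡))) (≤-reflexive exchange) ⟩
      sumFin (λ e → len e * abs (hits (below e) T * 1/suc k - Sample.p e)) + sumFin (λ e → len e * (1/suc k * sumFin (λ s → 𝟙 T s * Sample.deviation e k (T ∖ s))))
        ≡⟨ trans (sym (ΣF.S-+ (λ e → len e * abs (hits (below e) T * 1/suc k - Sample.p e)) (λ e → len e * (1/suc k * sumFin (λ s → 𝟙 T s * Sample.deviation e k (T ∖ s))))))
             (ΣF.S-cong (λ e → sym (*-distribˡ-+ (len e) (abs (hits (below e) T * 1/suc k - Sample.p e)) (1/suc k * sumFin (λ s → 𝟙 T s * Sample.deviation e k (T ∖ s)))))) ⟩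
      Φ (suc k) T ∎
      where
      open ≤-Reasoning
      lem : ∀ i l x → i * (l * x) ≡ l * (i * x)
      lem = solve-∀ ℚ-ring
      exchange : 1/suc k * sumFin (λ s → 𝟙 T s * Φ k (T ∖ s)) ≡ sumFin (λ e → len e * (1/suc k * sumFin (λ s → 𝟙 T s * Sample.deviation e k (T ∖ s))))
      exchange = begin-equality
        1/suc k * sumFin (λ s → 𝟙 T s * Φ k (T ∖ s))
          ≡⟨ cong (1/suc k *_) (ΣF.S-cong (λ s → trans (sym (ΣF.S-* (𝟙 T s) (λ e → len e * Sample.deviation e k (T ∖ s))))
               (ΣF.S-cong (λ e → lem (𝟙 T s) (len e) (Sample.deviation e k (T ∖ s)))))) ⟩
        1/suc k * sumFin (λ s → sumFin (λ e → len e * (𝟙 T s * Sample.deviation e k (T ∖ s))))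
          ≡⟨ cong (1/suc k *_) (trans (ΣF.S-comm-Fin (λ s e → len e * (𝟙 T s * Sample.deviation e k (T ∖ s))))
               (ΣF.S-cong (λ e → ΣF.S-* (len e) (λ s → 𝟙 T s * Sample.deviation e k (T ∖ s))))) ⟩
        1/suc k * sumFin (λ e → len e * sumFin (λ s → 𝟙 T s * Sample.deviation e k (T ∖ s)))
          ≡⟨ trans (sym (ΣF.S-* (1/suc k) (λ e → len e * sumFin (λ s → 𝟙 T s * Sample.deviation e k (T ∖ s)))))
               (ΣF.S-cong (λ e → lem (1/suc k) (len e) (sumFin (λ s → 𝟙 T s * Sample.deviation e k (T ∖ s))))) ⟩
        sumFin (λ e → len e * (1/suc k * sumFin (λ s → 𝟙 T s * Sample.deviation e k (T ∖ s)))) ∎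

  imbalance≤matchingCost : ∀ rs π → sumFin (λ e → len e * abs (Moment.Y e rs)) ≤ matchingCost rs π
  imbalance≤matchingCost rs π = begin
    sumFin (λ e → len e * abs (Moment.Y e rs))
      ≡⟨ ΣF.S-cong (λ e → cong (λ y → len e * abs y) (Y≡ e)) ⟩
    sumFin (λ e → len e * abs (sumFin (λ j → below e (lookup rs j) - below e (π ⟨$⟩ʳ j))))
      ≤⟨ ΣF.S-mono (λ e → ≤-trans (*-mono-nonneg (len≥0 e) (ΣF.abs-S (λ j → below e (lookup rs j) - below e (π ⟨$⟩ʳ j))))
           (≤-reflexive (sym (ΣF.S-* (len e) (λ j → abs (below e (lookup rs j) - below e (π ⟨$⟩ʳ j))))))) ⟩
    sumFin (λ e → sumFin (λ j → len e * abs (below e (lookup rs j) - below e (π ⟨$⟩ʳ j))))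
      ≡⟨ ΣF.S-comm-Fin (λ e j → len e * abs (below e (lookup rs j) - below e (π ⟨$⟩ʳ j))) ⟩
    sumFin (λ j → treeCost (λ e → below e (lookup rs j) - below e (π ⟨$⟩ʳ j)))
      ≤⟨ ΣF.S-mono (λ j → treeCost≤d (loc (lookup rs j)) (loc (π ⟨$⟩ʳ j))) ⟩
    matchingCost rs π ∎
    where
    open ≤-Reasoning
    -- Subtracting `p` once per request subtracts n p, the number of servers below `e`. A
    -- permutation preserves this total, so it can be distributed over the matched pairs.
    Y≡ : ∀ e → Moment.Y e rs ≡ sumFin (λ j → below e (lookup rs j) - below e (π ⟨$⟩ʳ j))
    Y≡ e = begin-equality
      sumFin (λ j → below e (lookup rs j) - Sample.p e)
        ≡⟨ ΣF.S-- (λ j → below e (lookup rs j)) (λ _ → Sample.p e) ⟩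
      sumFin (λ j → below e (lookup rs j)) - sumFin {n} (λ _ → Sample.p e)
        ≡⟨ cong (λ z → sumFin (λ j → below e (lookup rs j)) - z)
             (trans (sumFin-const n (Sample.p e)) (trans (Sample.n*p≡sum e) (sym (sumFin-permute (below e) π)))) ⟩
      sumFin (λ j → below e (lookup rs j)) - sumFin (λ j → below e (π ⟨$⟩ʳ j))
        ≡⟨ ΣF.S-- (λ j → below e (lookup rs j)) (λ j → below e (π ⟨$⟩ʳ j)) ⟨
      sumFin (λ j → below e (lookup rs j) - below e (π ⟨$⟩ʳ j)) ∎

  imbalance≤OPT : (opt : Vec (Fin n) n → ℚ) → (∀ rs → IsOPT rs (opt rs)) →
    sumFin (λ e → len e * 𝔼 n n (λ rs → abs (Moment.Y e rs))) ≤ expectedOPT opt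
  imbalance≤OPT opt isOPT = begin
    sumFin (λ e → len e * 𝔼 n n (λ rs → abs (Moment.Y e rs)))
      ≡⟨ ΣF.S-cong (λ e → 𝔼S.S-* (len e) (λ rs → abs (Moment.Y e rs))) ⟨
    sumFin (λ e → 𝔼 n n (λ rs → len e * abs (Moment.Y e rs)))
      ≡⟨ 𝔼S.S-comm-Fin (λ rs e → len e * abs (Moment.Y e rs)) ⟨
    𝔼 n n (λ rs → sumFin (λ e → len e * abs (Moment.Y e rs)))
      ≤⟨ 𝔼S.S-mono (λ rs → let (π , cost≡opt) = proj₁ (isOPT rs) in
           ≤-trans (imbalance≤matchingCost rs π) (≤-reflexive cost≡opt)) ⟩
    𝔼 n n opt
      ≡⟨ expectedOPT≡𝔼 n′ dist opt ⟨
    expectedOPT opt ∎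
    where
    open ≤-Reasoning
    module 𝔼S = IsSum (𝔼-isSum n n)

theorem4 : (n : ℕ) .{{_ : ℕ.NonZero n}} → 2 ℕ.≤ n →
    (m : ℕ) (t : Tree m) (d : Fin (suc m) → Fin (suc m) → ℚ) →
    IsShortestPathMetric t d →
    (loc : Fin n → Fin (suc m)) →
    let dist = λ (i j : Fin n) → d (loc i) (loc j) in
    (X : Subset n → Fin n → Fin n → ℚ) →
    (∀ T → Nonempty T → Matching.Optimal dist T (X T)) →
    (opt : Vec (Fin n) n → ℚ) →
    (∀ rs → Matching.IsOPT dist rs (opt rs)) →
    Matching.FairBias.expectedALG dist X ≤ ℕtoℚ 4 * Matching.expectedOPT dist opt
theorem4 (suc n′) 2≤n m t d metric loc X optimal opt isOPT = begin
  Matching.FairBias.expectedALG dist X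
    ≤⟨ ALG≤deviation X optimal ⟩
  sumFin (λ e → len e * Sample.deviation e n ⊤)
    ≤⟨ ΣF.S-mono (λ e → ≤-trans (*-mono-nonneg (len≥0 e) (Compare.deviation≤4𝔼∣Y∣ e))
         (≤-reflexive (lem (len e) (ℕtoℚ 4) (𝔼 n n (λ rs → abs (Moment.Y e rs)))))) ⟩
  sumFin (λ e → ℕtoℚ 4 * (len e * 𝔼 n n (λ rs → abs (Moment.Y e rs))))
    ≡⟨ ΣF.S-* (ℕtoℚ 4) (λ e → len e * 𝔼 n n (λ rs → abs (Moment.Y e rs))) ⟩
  ℕtoℚ 4 * sumFin (λ e → len e * 𝔼 n n (λ rs → abs (Moment.Y e rs)))
    ≤⟨ *-mono-nonneg (0≤ℕtoℚ 4) (imbalance≤OPT opt isOPT) ⟩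
  ℕtoℚ 4 * Matching.expectedOPT dist opt ∎
  where
  open Tree t
  open Competitive 2≤n t d metric loc
  open ≤-Reasoning
  lem : ∀ l c x → l * (c * x) ≡ c * (l * x)
  lem = solve-∀ ℚ-ring
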